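{- Let $q$ be a prime power and let $n,m,k$ be positive integers with $k\le n\le km$. Then $$ L_{\mathrm{rk}}(n,m,k,q)= \begin{cases} n-\max\left\{\left\lfloor \dfrac{n}{2^{k-1}}\right\rfloor,1\right\}+1 & \text{if } n\le m,\\[1em] m-\max\left\{\left\lfloor \dfrac{n-(k-t-2)m}{2^{t+1}}\right\rfloor,1\right\}+1 & \text{if } n>m, \end{cases} $$ where $t=\left\lfloor k-\dfrac{n}{m}\right\rfloor$.
   Context: $\mathbb{F}_{q^m}$ denotes the degree-$m$ extension of the finite field $\mathbb{F}_q$. For $\mathbf v=(v_1,\dots,v_n)\in\mathbb{F}_{q^m}^n$, its rank weight is $\mathrm{w}(\mathbf v)=\dim_{\mathbb{F}_q}\langle v_1,\dots,v_n\rangle_{\mathbb{F}_q}$. An $[n,k]_{q^m/q}$ code is a $k$-dimensional $\mathbb{F}_{q^m}$-linear subspace $\mathcal C$ of $\mathbb{F}_{q^m}^n$ (endowed with the rank distance $d(\mathbf u,\mathbf v)=\mathrm{w}(\mathbf u-\mathbf v)$). A generator matrix of $\mathcal C$ is a matrix $G\in\mathbb{F}_{q^m}^{k\times n}$ whose rows span $\mathcal C$. The code is nondegenerate if the $\mathbb{F}_q$-linear span of the columns of a generator matrix has $\mathbb{F}_q$-dimension $n$. The weight spectrum is $\mathrm{WS}(\mathcal C)=\{\mathrm{w}(\mathbf c):\mathbf c\in\mathcal C,\ \mathbf c\neq \mathbf 0\}$. $L_{\mathrm{rk}}(n,m,k,q)$ denotes the maximum of $|\mathrm{WS}(\mathcal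 C)|$ over all nondegenerate $[n,k]_{q^m/q}$ codes $\mathcal C$. -}

module Defs where

open import Level using (Level; _⊔_) renaming (suc to lsuc)
open import Algebra.Bundles using (CommutativeRing)
open import Algebra.Morphism.Structures using (module RingMorphisms)
open import Data.Nat using (ℕ; zero; suc; _≤_)
open import Data.Nat.Primality using (Prime)
import Data.Nat as N
open import Data.Fin using (Fin)
open import Data.Product using (Σ; ∃; _×_; _,_)
open import Relation.Binary.PropositionalEquality using (_≡_)
open import Relation.Nullary using (¬_)
open import Relation.Binary.Definitions using (Decidable)
import Algebra.Properties.Monoid.Sum as MonoidSum

record Field (c ℓ : Level) : Set (lsuc (c ⊔ ℓ)) where
  field
    commutativeRing : CommutativeRing c ℓ
  open CommutativeRing commutativeRing public
  field
    1≉0     : ¬ (1# ≈ 0#)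
    inverse : ∀ x → ¬ (x ≈ 0#) → ∃ λ y → x * y ≈ 1#

open Field using (Carrier)

IsPrimePower : ℕ → Set
IsPrimePower q = Σ ℕ λ p → Σ ℕ λ e → Prime p × (1 ≤ e) × (q ≡ p N.^ e)

HasCard : ∀ {c ℓ} → Field c ℓ → ℕ → Set (c ⊔ ℓ)
HasCard K q =
  Decidable (Field._≈_ K) ×
  Σ (Fin q → Carrier K) λ e →
    (∀ i j → Field._≈_ K (e i) (e j) → i ≡ j) ×
    (∀ x → ∃ λ i → Field._≈_ K (e i) x)

IsFieldHom : ∀ {c₁ ℓ₁ c₂ ℓ₂} (K : Field c₁ ℓ₁) (L : Field c₂ ℓ₂) →
             (Carrier K → Carrier L) → Set (c₁ ⊔ ℓ₁ ⊔ ℓ₂)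
IsFieldHom K L ι = RingMorphisms.IsRingHomomorphism (Field.rawRing K) (Field.rawRing L) ι

module Ext {c₁ ℓ₁ c₂ ℓ₂} (K : Field c₁ ℓ₁) (L : Field c₂ ℓ₂)
           (ι : Carrier K → Carrier L) where

  module K = Field K
  module L = Field L
  open MonoidSum L.+-monoid using (sum)

  Vec : ℕ → Set c₂
  Vec k = Fin k → L.Carrier

  _≋_ : ∀ {k} → Vec k → Vec k → Set ℓ₂
  u ≋ v = ∀ j → u j L.≈ v j

  zeroV : ∀ {k} → Vec k
  zeroV _ = L.0#

  kComb : ∀ {k r} → (Fin r → K.Carrier) → (Fin r → Vec k) → Vec k
  kComb {r = r} a v j = sum {r} (λ i → ι (a i) L.* v i j)

  InKSpan : ∀ {k r} → (Fin r → Vec k) → Vec k → Set (c₁ ⊔ ℓ₂)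
  InKSpan {r = r} v x = ∃ λ (a : Fin r → K.Carrier) → kComb a v ≋ x

  KIndep : ∀ {k r} → (Fin r → Vec k) → Set (c₁ ⊔ ℓ₁ ⊔ ℓ₂)
  KIndep u = ∀ a → kComb a u ≋ zeroV → ∀ i → a i K.≈ K.0#

  KSpanDim : ∀ {k r} → (Fin r → Vec k) → ℕ → Set (c₁ ⊔ ℓ₁ ⊔ c₂ ⊔ ℓ₂)
  KSpanDim v d = Σ (Fin d → Vec _) λ u →
    KIndep u × (∀ i → InKSpan v (u i)) × (∀ x → InKSpan v x → InKSpan u x)

  Degree : ℕ → Set (c₁ ⊔ ℓ₁ ⊔ c₂ ⊔ ℓ₂)
  Degree m = Σ (Fin m → L.Carrier) λ b →
    KIndep {1} (λ i _ → b i) × (∀ x → ∃ λ (a : Fin m → K.Carrier) → sum {m} (λ i → ι (a i) L.* b i) L.≈ x)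

  RankWeight : ∀ {n} → Vec n → ℕ → Set (c₁ ⊔ ℓ₁ ⊔ c₂ ⊔ ℓ₂)
  RankWeight {n} v d = KSpanDim {1} {n} (λ i _ → v i) d

  Matrix : ℕ → ℕ → Set c₂
  Matrix k n = Fin k → Fin n → L.Carrier

  codeword : ∀ {k n} → Matrix k n → Vec k → Vec n
  codeword {k} G x j = sum {k} (λ i → x i L.* G i j)

  -- rows of G are L-linearly independent, so G generates an [n,k] code
  RowsLIndep : ∀ {k n} → Matrix k n → Set (c₂ ⊔ ℓ₂)
  RowsLIndep G = ∀ x → codeword G x ≋ zeroV → ∀ i → x i L.≈ L.0#

  column : ∀ {k n} → Matrix k n → Fin n → Vec k
  column G j i = G i j

  Nondegenerate : ∀ {k n} → Matrix k n → Set (c₁ ⊔ ℓ₁ ⊔ c₂ ⊔ ℓ₂)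
  Nondegenerate {k} {n} G = KSpanDim (column G) n

  -- r ∈ WS(C) where C is the row space of G
  InWS : ∀ {k n} → Matrix k n → ℕ → Set (c₁ ⊔ ℓ₁ ⊔ c₂ ⊔ ℓ₂)
  InWS G r = ∃ λ x → ¬ (codeword G x ≋ zeroV) × RankWeight (codeword G x) r

  WSCard : ∀ {k n} → Matrix k n → ℕ → Set (c₁ ⊔ ℓ₁ ⊔ c₂ ⊔ ℓ₂)
  WSCard G N = Σ (Fin N → ℕ) λ e →
    (∀ i j → e i ≡ e j → i ≡ j) × (∀ i → InWS G (e i)) ×
    (∀ r → InWS G r → ∃ λ i → e i ≡ r)

  Attained : ℕ → ℕ → ℕ → Set (c₁ ⊔ ℓ₁ ⊔ c₂ ⊔ ℓ₂)
  Attained n k N = Σ (Matrix k n) λ G → RowsLIndep G × Nondegenerate G × WSCard G N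

  IsLrk : ℕ → ℕ → ℕ → Set (c₁ ⊔ ℓ₁ ⊔ c₂ ⊔ ℓ₂)
  IsLrk n k V = Attained n k V × (∀ N → Attained n k N → N ≤ V)

module Arith where
  open import Data.Nat using (_+_; _*_; _∸_; _^_; _/_) renaming (_⊔_ to _⊔ℕ_)
  open import Data.Nat.Properties using (m^n≢0)

  div2^ : ℕ → ℕ → ℕ
  div2^ a e = _/_ a (2 ^ e) {{m^n≢0 2 e}}

  ceilDiv : ℕ → ℕ → ℕ
  ceilDiv n zero = 0
  ceilDiv n (suc m') = (n + m') / suc m'

  -- t = ⌊ k - n/m ⌋ = k - ⌈n/m⌉  (nonnegative since n ≤ k m)
  tParam : ℕ → ℕ → ℕ → ℕ
  tParam n m k = k ∸ ceilDiv n m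

  formulaSmall : ℕ → ℕ → ℕ
  formulaSmall n k = n ∸ (div2^ n (k ∸ 1) ⊔ℕ 1) + 1

  formulaLarge : ℕ → ℕ → ℕ → ℕ
  formulaLarge n m k =
    let t = tParam n m k in
    m ∸ (div2^ (n ∸ (k ∸ t ∸ 2) * m) (t + 1) ⊔ℕ 1) + 1

open Arith public

{-# OPTIONS --safe #-}
-- A nondegenerate code is given by an n-dimensional K-subspace U of L^k (the span of the columns), and the
-- weight of the codeword of x is the dimension of the image of U under the functional x.
--
-- Upper bound.  Go through the weights in increasing order and choose a codeword whenever it is not in the
-- L-span of those chosen before; let w₁ ≤ w₂ ≤ … be the weights of the chosen words and S_j = w₁ + … + w_j.
-- Words in the span of the first j have weight at most S_j, so no weight lies strictly between S_j and w_{j+1},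
-- and S_{j+1} ≤ 2 S_j + 1 + (number of values skipped there).  Since n ≤ S_k and each w_j is at most m, about
-- n / 2^{k-1} (resp. (n − (k−t−2)m) / 2^{t+1}) values have to be skipped.
--
-- Sharpness.  Let β generate L over K.  Take U = U₁ × … × U_k with U_i spanned by 1, β, …, β^{w_i − 1}, where
-- w₁ = D is the least weight allowed by the formula and w_{i+1} ≤ min {w₁ + … + w_i + 1, m}.  Multiplying the U_i by
-- suitable powers of β makes their sum the span of 1, …, β^{r−1} for every r from D to min {n, m}.
--
-- Existence of β.  If 1, x, …, x^{m−1} are dependent over K, multiplication by x permutes the span of the first
-- r < m powers for some r ≥ 1, whence x^{q^r} = x; but the polynomials X^{q^r} − X with 1 ≤ r < m have fewer
-- than q^m roots altogether.

module Submission where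

open import Defs
open import Level using (Level)
open import Algebra.Bundles using (Monoid)
open import Algebra.Morphism.Structures using (module RingMorphisms)
open import Data.Fin using (Fin; zero; suc; toℕ; fromℕ; fromℕ<; inject₁; inject≤; splitAt; join; _↑ˡ_; _↑ʳ_; punchIn; punchOut; combine; finToFun; funToFin)
open import Data.Fin.Permutation using (Permutation; permutation)
open import Data.Fin.Properties as Fin using (any?; toℕ<n; toℕ-injective; toℕ-fromℕ; toℕ-fromℕ<; toℕ-inject₁; toℕ-inject≤; inject≤-injective; splitAt-↑ˡ; splitAt-↑ʳ; join-splitAt; punchIn-punchOut; punchOut-injective)
open import Data.List as List using (List; []; _∷_; length)
open import Data.List.Membership.Propositional using (_∈_)
open import Data.List.Membership.Propositional.Properties using (∈-filter⁻)
open import Data.List.Properties using (length-tabulate)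
open import Data.List.Relation.Unary.All as All using (All; []; _∷_)
open import Data.List.Relation.Unary.All.Properties using (all-filter)
open import Data.List.Relation.Unary.AllPairs using (AllPairs; []; _∷_)
import Data.List.Relation.Unary.AllPairs.Properties as AllPairs
open import Data.List.Relation.Unary.Any using (here; there; index)
open import Data.List.Relation.Unary.Any.Properties using (lookup-index)
open import Data.Maybe using (Maybe; just; nothing)
open import Data.Maybe.Properties using (just-injective)
open import Data.Nat as ℕ using (ℕ; zero; suc; _≤_; _<_; _*_; z≤n; s≤s)
import Data.Nat.Properties as ℕ
open import Data.Nat.Tactic.RingSolver using (solve-∀)
open import Data.Product using (Σ; ∃; ∃₂; _×_; _,_; proj₁; proj₂)
open import Data.Sum using (_⊎_; inj₁; inj₂; [_,_]′)
open import Data.Vec as Vec using ([]; _∷_; replicate)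
open import Function using (_∘_; id)
open import Relation.Binary.Definitions using (Decidable)
open import Relation.Binary.PropositionalEquality as ≡ using (_≡_)
open import Relation.Nullary using (¬_; Dec; yes; no; contradiction)
open import Relation.Nullary.Decidable using (map′; ¬?; decidable-stable)
open import Relation.Unary using (Pred) renaming (Decidable to Decidable₁)
import Algebra.Properties.CommutativeMonoid.Sum as CommutativeMonoidSum
import Algebra.Properties.Group as GroupProperties
import Algebra.Properties.Monoid.Sum as MonoidSum
import Algebra.Properties.Semiring.Exp as SemiringExp
import Algebra.Properties.Semiring.Sum as SemiringSum

-- Arithmetic of block layouts, of chains of weights and of the two formulas

module Numerics where

  open import Data.Nat
  open import Data.Nat.DivMod
  open import Data.Nat.Properties
  open import Relation.Binary.PropositionalEquality

  -- Describes the generator matrix whose j-th column has its only nonzero entry β ^ exponent j in row block j.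
  -- Taking the b-th coordinate of x to be β ^ shift b (0 for nothing), the nonzero entries of the codeword
  -- of x are β ^ 0, …, β ^ (r ∸ 1), so its weight is r.
  record Layout (m D k n : ℕ) : Set where
    field
      block      : Fin n → Fin k
      exponent   : Fin n → ℕ
      exponent<m : ∀ j → exponent j < m
      injective  : ∀ i j → block i ≡ block j → exponent i ≡ exponent j → i ≡ j
      surjective : ∀ b → ∃ λ j → block j ≡ b
      cover      : ∀ r → D ≤ r → r ≤ n → r ≤ m → ∃ λ (shift : Fin k → Maybe ℕ) →
        (∀ j e → shift (block j) ≡ just e → e + exponent j < r) ×
        (∀ p → p < r → ∃ λ j → ∃ λ e → shift (block j) ≡ just e × e + exponent j ≡ p)

  singleBlock : ∀ {m D} → 1 ≤ D → D ≤ m → Layout m D 1 D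
  singleBlock {m} {D} 1≤D D≤m = record
    { block      = λ _ → zero
    ; exponent   = toℕ
    ; exponent<m = λ j → ≤-trans (toℕ<n j) D≤m
    ; injective  = λ i j _ → toℕ-injective
    ; surjective = λ { zero → fromℕ< 1≤D , refl }
    ; cover      = λ r D≤r r≤D _ → (λ _ → just 0) ,
        (λ { j _ refl → ≤-trans (toℕ<n j) D≤r }) ,
        λ p p<r → fromℕ< (≤-trans p<r r≤D) , 0 , refl , toℕ-fromℕ< (≤-trans p<r r≤D)
    }

  -- If the old blocks can fill [0, n) and r > n, then putting the new block at [r ∸ w, r) fills [0, r).
  addBlock : ∀ {m D k n} w → 1 ≤ w → w ≤ suc n → w ≤ m → D ≤ n →
             Layout m D k n → Layout m D (suc k) (w + n)
  addBlock {m} {D} {k} {n} w 1≤w w≤1+n w≤m D≤n ℓ = record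
    { block      = blockS ∘ splitAt w
    ; exponent   = exponentS ∘ splitAt w
    ; exponent<m = λ j → exponentS<m (splitAt w j)
    ; injective  = inj
    ; surjective = sur
    ; cover      = cov
    }
    where
    open Layout ℓ
    blockS : Fin w ⊎ Fin n → Fin (suc k)
    blockS (inj₁ _) = zero
    blockS (inj₂ j) = suc (block j)
    exponentS : Fin w ⊎ Fin n → ℕ
    exponentS (inj₁ p) = toℕ p
    exponentS (inj₂ j) = exponent j
    exponentS<m : ∀ s → exponentS s < m
    exponentS<m (inj₁ p) = ≤-trans (toℕ<n p) w≤m
    exponentS<m (inj₂ j) = exponent<m j
    injS : ∀ s t → blockS s ≡ blockS t → exponentS s ≡ exponentS t → s ≡ t
    injS (inj₁ p) (inj₁ p′) _  eq = cong inj₁ (toℕ-injective eq)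
    injS (inj₂ j) (inj₂ j′) eb eq = cong inj₂ (injective j j′ (Fin.suc-injective eb) eq)
    inj : ∀ i j → blockS (splitAt w i) ≡ blockS (splitAt w j) →
          exponentS (splitAt w i) ≡ exponentS (splitAt w j) → i ≡ j
    inj i j eb ee = begin
      i                          ≡⟨ join-splitAt w n i ⟨
      join w n (splitAt w i)     ≡⟨ cong (join w n) (injS _ _ eb ee) ⟩
      join w n (splitAt w j)     ≡⟨ join-splitAt w n j ⟩
      j                          ∎
      where open ≡-Reasoning
    sur : ∀ b → ∃ λ j → blockS (splitAt w j) ≡ b
    sur zero    = fromℕ< 1≤w ↑ˡ n , cong blockS (splitAt-↑ˡ w (fromℕ< 1≤w) n)
    sur (suc b) with surjective b
    ... | j , eq = w ↑ʳ j , trans (cong blockS (splitAt-↑ʳ w n j)) (cong suc eq)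
    Fills : ℕ → (Fin (suc k) → Maybe ℕ) → Set
    Fills r shift =
      (∀ j e → shift (blockS (splitAt w j)) ≡ just e → e + exponentS (splitAt w j) < r) ×
      (∀ p → p < r → ∃ λ j → ∃ λ e →
        shift (blockS (splitAt w j)) ≡ just e × e + exponentS (splitAt w j) ≡ p)
    extend : ∀ {A : Set} → A → (Fin k → A) → Fin (suc k) → A
    extend x f zero    = x
    extend x f (suc i) = f i
    cov : ∀ r → D ≤ r → r ≤ w + n → r ≤ m → ∃ (Fills r)
    cov r D≤r r≤w+n r≤m with r ≤? n
    ... | yes r≤n with cover r D≤r r≤n r≤m
    ...   | shift , below , onto = extend nothing shift , (λ j → below′ (splitAt w j)) , onto′
      where
      below′ : ∀ s e → extend nothing shift (blockS s) ≡ just e → e + exponentS s < r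
      below′ (inj₂ j) e eq = below j e eq
      onto′ : ∀ p → p < r → _
      onto′ p p<r with onto p p<r
      ... | j , e , se , ep = w ↑ʳ j , e ,
        trans (cong (extend nothing shift ∘ blockS) (splitAt-↑ʳ w n j)) se ,
        trans (cong (λ s → e + exponentS s) (splitAt-↑ʳ w n j)) ep
    cov r D≤r r≤w+n r≤m | no r≰n with cover n D≤n ≤-refl (≤-trans (<⇒≤ (≰⇒> r≰n)) r≤m)
    ... | shift , below , onto = extend (just (r ∸ w)) shift , (λ j → below′ (splitAt w j)) , onto′
      where
      w≤r : w ≤ r
      w≤r = ≤-trans w≤1+n (≰⇒> r≰n)
      below′ : ∀ s e → extend (just (r ∸ w)) shift (blockS s) ≡ just e → e + exponentS s < r
      below′ (inj₁ p) _ refl = subst (r ∸ w + toℕ p <_) (m∸n+n≡m w≤r) (+-monoʳ-< (r ∸ w) (toℕ<n p))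
      below′ (inj₂ j) e eq   = <-trans (below j e eq) (≰⇒> r≰n)
      onto′ : ∀ p → p < r → _
      onto′ p p<r with p <? n
      ... | yes p<n with onto p p<n
      ...   | j , e , se , ep = w ↑ʳ j , e ,
        trans (cong (extend (just (r ∸ w)) shift ∘ blockS) (splitAt-↑ʳ w n j)) se ,
        trans (cong (λ s → e + exponentS s) (splitAt-↑ʳ w n j)) ep
      onto′ p p<r | no p≮n = i ↑ˡ n , r ∸ w ,
        cong (extend (just (r ∸ w)) shift ∘ blockS) (splitAt-↑ˡ w i n) ,
        trans (cong (λ s → r ∸ w + exponentS s) (splitAt-↑ˡ w i n))
          (trans (cong (r ∸ w +_) (toℕ-fromℕ< _)) (m+[n∸m]≡n r∸w≤p))
        where
        r∸w≤p : r ∸ w ≤ p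
        r∸w≤p = ≤-trans (m≤n+o⇒m∸n≤o r w r≤w+n) (≮⇒≥ p≮n)
        i : Fin w
        i = fromℕ< {p ∸ (r ∸ w)} (+-cancelˡ-< (r ∸ w) _ _
              (subst₂ _<_ (sym (m+[n∸m]≡n r∸w≤p)) (sym (m∸n+n≡m w≤r)) p<r))

  -- The greatest length obtained from a block of size `D` by `i` uses of `addBlock`, each with `w`
  -- as large as its hypotheses allow.
  reach : ℕ → ℕ → ℕ → ℕ
  reach D m zero    = D
  reach D m (suc i) = suc (reach D m i) ⊓ m + reach D m i

  D+i≤reach : ∀ {D m} → 1 ≤ m → ∀ i → D + i ≤ reach D m i
  D+i≤reach {D} 1≤m zero    = ≤-reflexive (+-identityʳ D)
  D+i≤reach {D} 1≤m (suc i) rewrite +-suc D i = +-mono-≤ (⊓-glb (s≤s z≤n) 1≤m) (D+i≤reach 1≤m i)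

  layout : ∀ {m D} → 1 ≤ m → 1 ≤ D → D ≤ m → ∀ i n → D + i ≤ n → n ≤ reach D m i → Layout m D (suc i) n
  layout {m} {D} 1≤m 1≤D D≤m zero n D+0≤n n≤D
    rewrite ≤-antisym n≤D (≤-trans (m≤m+n D 0) D+0≤n) = singleBlock 1≤D D≤m
  layout {m} {D} 1≤m 1≤D D≤m (suc i) n D+1+i≤n n≤reach =
    subst (Layout m D (suc (suc i))) (m∸n+n≡m n′≤n)
      (addBlock (n ∸ n′) 1≤w w≤1+n′ w≤m (≤-trans (m≤m+n D i) D+i≤n′)
        (layout 1≤m 1≤D D≤m i n′ D+i≤n′ (m⊓n≤m R (pred n))))
    where
    R = reach D m i
    -- The earlier blocks take all they can reach, except that one column is kept for the new block.
    n′ = R ⊓ pred n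
    1+D+i≤n : suc (D + i) ≤ n
    1+D+i≤n = subst (_≤ n) (+-suc D i) D+1+i≤n
    n′<n : n′ < n
    n′<n = <-≤-trans (s≤s (m⊓n≤n R (pred n))) (≤-reflexive (suc-pred n {{>-nonZero (≤-trans (s≤s z≤n) 1+D+i≤n)}}))
    n′≤n : n′ ≤ n
    n′≤n = <⇒≤ n′<n
    D+i≤n′ : D + i ≤ n′
    D+i≤n′ = ⊓-glb (D+i≤reach 1≤m i) (pred-mono-≤ 1+D+i≤n)
    1≤w : 1 ≤ n ∸ n′
    1≤w = m<n⇒0<n∸m n′<n
    w≤ : n ∸ n′ ≤ suc n′ ⊓ m
    w≤ with ≤-total R (pred n)
    ... | inj₁ R≤ rewrite m≤n⇒m⊓n≡m R≤ = m≤n+o⇒m∸n≤o n R (subst (n ≤_) (+-comm _ R) n≤reach)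
    ... | inj₂ ≤R rewrite m≥n⇒m⊓n≡n ≤R =
      ≤-trans (m≤n+o⇒m∸n≤o n (pred n) (subst (n ≤_) (+-comm 1 (pred n)) (m≤1+pred n))) (⊓-glb (s≤s z≤n) 1≤m)
      where
      m≤1+pred : ∀ x → x ≤ suc (pred x)
      m≤1+pred zero    = z≤n
      m≤1+pred (suc x) = ≤-refl
    w≤1+n′ : n ∸ n′ ≤ suc n′
    w≤1+n′ = ≤-trans w≤ (m⊓n≤m _ m)
    w≤m : n ∸ n′ ≤ m
    w≤m = ≤-trans w≤ (m⊓n≤n _ m)

  ⌈m/2⌉≤ : ∀ {m n} → m ≤ n + n → ⌈ m /2⌉ ≤ n
  ⌈m/2⌉≤ {m} {n} m≤ = subst (⌈ m /2⌉ ≤_) (sym (n≡⌈n+n/2⌉ n)) (⌈n/2⌉-mono m≤)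

  -- Halving: the larger half of `n` serves as the last block, since it exceeds the other half by at
  -- most one and `n ≤ m + m` keeps it within `m`. The smaller half is reached by induction.
  ≤reach : ∀ D m i {n} → n ≤ m + m → n < 2 ^ i * suc D → n ≤ reach D m i
  ≤reach D m zero    _   n<  rewrite +-identityʳ D = ≤-pred n<
  ≤reach D m (suc i) {n} n≤ n< = begin
    n                                 ≡⟨ ⌊n/2⌋+⌈n/2⌉≡n n ⟨
    ⌊ n /2⌋ + ⌈ n /2⌉                 ≡⟨ +-comm ⌊ n /2⌋ _ ⟩
    ⌈ n /2⌉ + ⌊ n /2⌋                 ≤⟨ +-mono-≤ (⊓-glb (≤-trans ⌈n/2⌉≤1+ (s≤s half)) (⌈m/2⌉≤ n≤)) half ⟩
    suc (reach D m i) ⊓ m + reach D m i ∎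
    where
    open ≤-Reasoning
    B = 2 ^ i * suc D
    2B : 2 ^ suc i * suc D ≡ B + B
    2B = trans (*-assoc 2 (2 ^ i) (suc D)) (cong (B +_) (+-identityʳ B))
    ⌈n/2⌉≤1+ : ⌈ n /2⌉ ≤ suc ⌊ n /2⌋
    ⌈n/2⌉≤1+ = ⌊n/2⌋-mono (n≤1+n (suc n))
    half : ⌊ n /2⌋ ≤ reach D m i
    -- `⌈ suc n /2⌉` computes to `suc ⌊ n /2⌋`, so the strict inequality survives halving.
    half = ≤reach D m i (≤-trans (⌊n/2⌋≤n n) n≤) (⌈m/2⌉≤ (subst (suc n ≤_) 2B n<))

  -- The first `i` words are charged to doubling of `suc S`, up to `g` skipped values, and the last
  -- `d` to the weight bound `M`. This is `suc S ≤ 2^(i-1) (2 + g) + d M`, doubled to make sense for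
  -- `i = 0`.
  ChainBound : ℕ → ℕ → ℕ → ℕ → Set
  ChainBound M j S g = ∀ i d → j ≡ i + d → 2 * suc S ≤ 2 ^ i * (2 + g) + 2 * (d * M)

  bound-start : ∀ {M} → ChainBound M 0 0 0
  bound-start zero zero refl = ≤-refl

  bound-mono : ∀ {M j S g g′} → g ≤ g′ → ChainBound M j S g → ChainBound M j S g′
  bound-mono g≤g′ b i d eq = ≤-trans (b i d eq) (+-monoˡ-≤ _ (*-monoʳ-≤ (2 ^ i) (+-monoʳ-≤ 2 g≤g′)))

  -- If no word is charged to `M`, then `e ≤ δ + suc S` gives `suc (S + e) ≤ 2 * suc S + δ`, and `δ`
  -- is absorbed because its coefficient on the right is at least one. Otherwise the new word itself
  -- is charged to `M`.
  bound-step : ∀ {M j S g} e δ → e ≤ M → e ≤ δ + suc S → ChainBound M j S g → ChainBound M (suc j) (S + e) (g + δ)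
  bound-step {M} {j} {S} {g} e δ e≤M e≤δ+S b i zero eq
    rewrite +-identityʳ i | sym eq = begin
      2 * suc (S + e)                               ≤⟨ *-monoʳ-≤ 2 (s≤s (+-monoʳ-≤ S e≤δ+S)) ⟩
      2 * suc (S + (δ + suc S))                     ≡⟨ cong (2 *_) (double S δ) ⟩
      2 * (2 * suc S + δ)                           ≤⟨ *-monoʳ-≤ 2 (+-mono-≤ (b j 0 (sym (+-identityʳ j)))
                                                         (m≤n*m δ (2 ^ j) {{m^n≢0 2 j}})) ⟩
      2 * (2 ^ j * (2 + g) + 0 + 2 ^ j * δ)         ≡⟨ collect (2 ^ j) g δ ⟩
      2 ^ suc j * (2 + (g + δ)) + 0                 ∎
    where
    open ≤-Reasoning
    double : ∀ S δ → suc (S + (δ + suc S)) ≡ 2 * suc S + δ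
    double = solve-∀
    collect : ∀ P g δ → 2 * (P * (2 + g) + 0 + P * δ) ≡ 2 * P * (2 + (g + δ)) + 0
    collect = solve-∀
  bound-step {M} {j} {S} {g} e δ e≤M e≤δ+S b i (suc d) eq = begin
      2 * suc (S + e)                               ≡⟨ *-distribˡ-+ 2 (suc S) e ⟩
      2 * suc S + 2 * e                             ≤⟨ +-mono-≤ (bound-mono {M} {j} {S} (m≤m+n g δ) b i d
                                                         (suc-injective (trans eq (+-suc i d)))) (*-monoʳ-≤ 2 e≤M) ⟩
      2 ^ i * (2 + (g + δ)) + 2 * (d * M) + 2 * M   ≡⟨ collect (2 ^ i * (2 + (g + δ))) (d * M) M ⟩
      2 ^ i * (2 + (g + δ)) + 2 * (M + d * M)       ∎
    where
    open ≤-Reasoning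
    collect : ∀ A B M → A + 2 * B + 2 * M ≡ A + 2 * (M + B)
    collect = solve-∀

  -- The first `suc i` words are charged to doubling and the others, at most `s`, to `M`; if
  -- `j ≤ suc i`, all are charged to doubling. A factor 2 then cancels.
  bound-end : ∀ {M i s j d S g} → j + d ≡ suc i + s → ChainBound M j S g → suc S ≤ 2 ^ i * (2 + g) + s * M
  bound-end {M} {i} {s} {j} {d} {S} {g} eq b = *-cancelˡ-≤ 2 (begin
    2 * suc S                              ≤⟨ doubled ⟩
    2 ^ suc i * (2 + g) + 2 * (s * M)      ≡⟨ collect (2 ^ i) (2 + g) (s * M) ⟩
    2 * (2 ^ i * (2 + g) + s * M)          ∎)
    where
    open ≤-Reasoning
    collect : ∀ A B C → 2 * A * B + 2 * C ≡ 2 * (A * B + C)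
    collect = solve-∀
    doubled : 2 * suc S ≤ 2 ^ suc i * (2 + g) + 2 * (s * M)
    doubled with ≤-total j (suc i)
    ... | inj₁ j≤1+i = ≤-trans (b j 0 (sym (+-identityʳ j)))
      (+-mono-≤ (*-monoˡ-≤ (2 + g) (^-monoʳ-≤ 2 j≤1+i)) z≤n)
    ... | inj₂ 1+i≤j = ≤-trans (b (suc i) (j ∸ suc i) (sym (m+[n∸m]≡n 1+i≤j)))
      (+-monoʳ-≤ (2 ^ suc i * (2 + g)) (*-monoʳ-≤ 2 (*-monoˡ-≤ M
        (m≤n+o⇒m∸n≤o j (suc i) (subst (j ≤_) eq (m≤m+n j d))))))

  -- Once `m` is reached, the cap `m` is the active one, so every further block adds a full `m`.
  reach-+ : ∀ D m i s → m ≤ reach D m i → reach D m i + s * m ≤ reach D m (i + s)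
  reach-+ D m i zero    m≤ rewrite +-identityʳ i = ≤-reflexive (+-identityʳ _)
  reach-+ D m i (suc s) m≤ rewrite +-suc i s = begin
    reach D m i + (m + s * m)                            ≡⟨ exchange (reach D m i) m (s * m) ⟩
    m + (reach D m i + s * m)                            ≤⟨ +-mono-≤ (⊓-glb (m≤n⇒m≤1+n (≤-trans m≤ R≤)) ≤-refl) ih ⟩
    suc (reach D m (i + s)) ⊓ m + reach D m (i + s)      ∎
    where
    open ≤-Reasoning
    exchange : ∀ a b c → a + (b + c) ≡ b + (a + c)
    exchange = solve-∀
    ih = reach-+ D m i s m≤
    R≤ : reach D m i ≤ reach D m (i + s)
    R≤ = ≤-trans (m≤m+n _ (s * m)) ih

  x+i≤2^i*x : ∀ {x} → 1 ≤ x → ∀ i → x + i ≤ 2 ^ i * x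
  x+i≤2^i*x {x} 1≤x zero    = ≤-refl
  x+i≤2^i*x {x} 1≤x (suc i) = begin
    x + suc i                    ≡⟨ +-suc x i ⟩
    1 + (x + i)                  ≤⟨ +-mono-≤ (*-mono-≤ (m^n>0 2 i) 1≤x) (x+i≤2^i*x 1≤x i) ⟩
    2 ^ i * x + 2 ^ i * x        ≡⟨ double (2 ^ i) x ⟩
    2 ^ suc i * x                ∎
    where
    open ≤-Reasoning
    double : ∀ P x → P * x + P * x ≡ 2 * P * x
    double = solve-∀

  -- n′ and i stand for n − (k−t−2)m and t+1 when n > m, and for n and k−1 when n ≤ m (with s = 0);
  -- M = min {n, m}.
  record Parameters (m n k : ℕ) : Set where
    field
      i s n′ M : ℕ
      k≡       : k ≡ suc i + s
      n≡       : n ≡ n′ + s * m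
      n′≤2m    : n′ ≤ m + m
      s≡0⊎m≤n′ : s ≡ 0 ⊎ m ≤ n′
      M≡       : M ≡ n ⊎ M ≡ m
      M≤n      : M ≤ n
      M≤m      : M ≤ m
    D : ℕ
    D = div2^ n′ i ⊔ 1
    field
      D≤M      : D ≤ M

    1≤D : 1 ≤ D
    1≤D = m≤n⊔m (div2^ n′ i) 1

    -- The length forces at least `D ∸ 1` skipped values: `n ≤ S` and the chain bound give
    -- `n′ < (2 + g) * 2 ^ i`, hence `D ≤ 1 + g`.
    count≤ : ∀ {j d S g N} → j + d ≡ k → ChainBound M j S g → n ≤ S → g + N ≤ M → N ≤ M ∸ D + 1
    count≤ {j} {d} {S} {g} {N} eq bound n≤S g+N≤M = begin
      N              ≤⟨ m+n≤o⇒m≤o∸n N N+D≤1+M ⟩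
      suc M ∸ D      ≡⟨ +-∸-assoc 1 D≤M ⟩
      1 + (M ∸ D)    ≡⟨ +-comm 1 _ ⟩
      M ∸ D + 1      ∎
      where
      open ≤-Reasoning
      n′< : n′ < (2 + g) * 2 ^ i
      n′< = +-cancelʳ-< (s * m) n′ _ (begin-strict
        n′ + s * m                     ≡⟨ n≡ ⟨
        n                              ≤⟨ n≤S ⟩
        S                              <⟨ bound-end {M} {i} {s} {j} {d} {S} {g} (trans eq k≡) bound ⟩
        2 ^ i * (2 + g) + s * M        ≤⟨ +-monoʳ-≤ _ (*-monoʳ-≤ s M≤m) ⟩
        2 ^ i * (2 + g) + s * m        ≡⟨ cong (_+ s * m) (*-comm (2 ^ i) (2 + g)) ⟩
        (2 + g) * 2 ^ i + s * m        ∎)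
      D≤1+g : D ≤ 1 + g
      D≤1+g = ⊔-lub (≤-pred (m<n*o⇒m/o<n {{m^n≢0 2 i}} n′<)) (s≤s z≤n)
      N+D≤1+M : N + D ≤ suc M
      N+D≤1+M = begin
        N + D            ≤⟨ +-monoʳ-≤ N D≤1+g ⟩
        N + (1 + g)      ≡⟨ +-suc N g ⟩
        suc (N + g)      ≡⟨ cong suc (+-comm N g) ⟩
        suc (g + N)      ≤⟨ s≤s g+N≤M ⟩
        suc M            ∎

    -- `layout` needs a column for each block after the first. If the quotient in `D` is zero, this
    -- is `k ≤ n`; otherwise `D * 2 ^ i ≤ n′` leaves room for `i` blocks and `s * m` for the other
    -- `s`.
    D+i+s≤n : 1 ≤ m → k ≤ n → D + (i + s) ≤ n
    D+i+s≤n 1≤m k≤n with div2^ n′ i in eq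
    ... | zero  = subst (_≤ n) k≡ k≤n
    ... | suc x rewrite ⊔-identityʳ x = begin
      suc x + (i + s)       ≡⟨ +-assoc (suc x) i s ⟨
      suc x + i + s         ≤⟨ +-mono-≤ (x+i≤2^i*x (s≤s z≤n) i) (m≤m*n s m {{>-nonZero 1≤m}}) ⟩
      2 ^ i * suc x + s * m ≡⟨ cong (_+ s * m) (*-comm (2 ^ i) (suc x)) ⟩
      suc x * 2 ^ i + s * m ≡⟨ cong (λ z → z * 2 ^ i + s * m) eq ⟨
      div2^ n′ i * 2 ^ i + s * m ≤⟨ +-monoˡ-≤ (s * m) (m/n*n≤m n′ (2 ^ i) {{m^n≢0 2 i}}) ⟩
      n′ + s * m            ≡⟨ n≡ ⟨
      n                     ∎
      where open ≤-Reasoning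

    -- Since `D` is at least the quotient of `n′` by `2 ^ i`, `≤reach` covers `n′`; the remaining
    -- `s` blocks add `m` each by `reach-+`.
    n≤reach : n ≤ reach D m (i + s)
    n≤reach = begin
      n                         ≡⟨ n≡ ⟩
      n′ + s * m                ≤⟨ +-monoˡ-≤ (s * m) n′≤reach ⟩
      reach D m i + s * m       ≤⟨ reach+ s≡0⊎m≤n′ ⟩
      reach D m (i + s)         ∎
      where
      open ≤-Reasoning
      n′≤reach : n′ ≤ reach D m i
      n′≤reach = ≤reach D m i n′≤2m (begin-strict
        n′                                              ≡⟨ m≡m%n+[m/n]*n n′ (2 ^ i) {{m^n≢0 2 i}} ⟩
        _%_ n′ (2 ^ i) {{m^n≢0 2 i}} + div2^ n′ i * 2 ^ i    <⟨ +-monoˡ-< _ (m%n<n n′ (2 ^ i) {{m^n≢0 2 i}}) ⟩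
        suc (div2^ n′ i) * 2 ^ i                        ≤⟨ *-monoˡ-≤ (2 ^ i) (s≤s (m≤m⊔n (div2^ n′ i) 1)) ⟩
        suc D * 2 ^ i                                   ≡⟨ *-comm (suc D) (2 ^ i) ⟩
        2 ^ i * suc D                                   ∎)
      reach+ : s ≡ 0 ⊎ m ≤ n′ → reach D m i + s * m ≤ reach D m (i + s)
      reach+ (inj₁ s≡0) = ≤-reflexive (trans (cong (λ z → reach D m i + z * m) s≡0)
        (trans (+-identityʳ _) (cong (reach D m) (sym (trans (cong (i +_) s≡0) (+-identityʳ i))))))
      reach+ (inj₂ m≤n′) = reach-+ D m i s (≤-trans m≤n′ n′≤reach)

  parametersSmall : ∀ {m n k} → 1 ≤ n → 1 ≤ k → n ≤ m → Parameters m n k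
  parametersSmall {m} {n} {suc k} 1≤n _ n≤m = record
    { i = k ; s = 0 ; n′ = n ; M = n
    ; k≡ = cong suc (sym (+-identityʳ k)) ; n≡ = sym (+-identityʳ n)
    ; n′≤2m = ≤-trans n≤m (m≤m+n m m) ; s≡0⊎m≤n′ = inj₁ refl
    ; M≡ = inj₁ refl ; M≤n = ≤-refl ; M≤m = n≤m
    ; D≤M = ⊔-lub (m/n≤m n (2 ^ k) {{m^n≢0 2 k}}) 1≤n
    }

  -- Here `a` is `n / m` rounded up and equals `k ∸ t`; `m < n` gives `2 ≤ a`, so `s = a ∸ 2` is not
  -- truncated. The inequalities `(a - 1) m ≤ n ≤ a m` place `n′` between `m` and `2 m`.
  parametersLarge : ∀ {m n k} → 1 ≤ m → m < n → n ≤ k * m → Parameters m n k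
  parametersLarge {m@(suc m′)} {n} {k} 1≤m m<n n≤km = record
    { i = t + 1 ; s = s ; n′ = n ∸ s * m ; M = m
    ; k≡ = k≡ ; n≡ = sym (m∸n+n≡m s*m≤n)
    ; n′≤2m = n′≤2m
    ; s≡0⊎m≤n′ = inj₂ (m+n≤o⇒m≤o∸n m [1+s]m≤n)
    ; M≡ = inj₂ refl ; M≤n = <⇒≤ m<n ; M≤m = ≤-refl
    ; D≤M = ⊔-lub (≤-pred (m<n*o⇒m/o<n {{m^n≢0 2 (t + 1)}} n′<)) 1≤m
    }
    where
    open ≤-Reasoning
    a = ceilDiv n m
    t = tParam n m k
    s = k ∸ t ∸ 2
    n+m′≡ : n + m′ ≡ (n + m′) % m + a * m
    n+m′≡ = m≡m%n+[m/n]*n (n + m′) m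
    2≤a : 2 ≤ a
    2≤a = begin
      2                ≡⟨ m*n/n≡m 2 m ⟨
      2 * m / m        ≤⟨ /-monoˡ-≤ m (begin
        m + (m + 0)    ≡⟨ lemma m′ ⟩
        suc m + m′     ≤⟨ +-monoˡ-≤ m′ m<n ⟩
        n + m′         ∎) ⟩
      a                ∎
      where
      lemma : ∀ x → suc x + (suc x + 0) ≡ suc (suc x) + x
      lemma = solve-∀
    a≤k : a ≤ k
    a≤k = ≤-pred (m<n*o⇒m/o<n (begin-strict
      n + m′       ≤⟨ +-monoˡ-≤ m′ n≤km ⟩
      k * m + m′   <⟨ +-monoʳ-< (k * m) (n<1+n m′) ⟩
      k * m + m    ≡⟨ +-comm (k * m) m ⟩
      suc k * m    ∎))
    n≤am : n ≤ a * m
    n≤am = +-cancelʳ-≤ m′ n (a * m) (begin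
      n + m′                   ≡⟨ n+m′≡ ⟩
      (n + m′) % m + a * m     ≤⟨ +-monoˡ-≤ (a * m) (≤-pred (m%n<n (n + m′) m)) ⟩
      m′ + a * m               ≡⟨ +-comm m′ _ ⟩
      a * m + m′               ∎)
    am≤n+m′ : a * m ≤ n + m′
    am≤n+m′ = m/n*n≤m (n + m′) m
    k∸t≡a : k ∸ t ≡ a
    k∸t≡a = m∸[m∸n]≡n a≤k
    a≡2+s : a ≡ 2 + s
    a≡2+s = trans (sym (m+[n∸m]≡n 2≤a)) (cong (λ z → 2 + (z ∸ 2)) (sym k∸t≡a))
    k≡ : k ≡ suc (t + 1) + s
    k≡ = begin-equality
      k                  ≡⟨ m∸n+n≡m a≤k ⟨
      t + a              ≡⟨ cong (t +_) a≡2+s ⟩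
      t + (2 + s)        ≡⟨ lemma t s ⟩
      suc (t + 1) + s    ∎
      where
      lemma : ∀ t s → t + (2 + s) ≡ suc (t + 1) + s
      lemma = solve-∀
    [1+s]m≤n : m + s * m ≤ n
    [1+s]m≤n = +-cancelʳ-≤ m (m + s * m) n (begin
      m + s * m + m      ≡⟨ lemma m (s * m) ⟩
      m + (m + s * m)    ≡⟨ cong (_* m) a≡2+s ⟨
      a * m              ≤⟨ am≤n+m′ ⟩
      n + m′             ≤⟨ +-monoʳ-≤ n (n≤1+n m′) ⟩
      n + m              ∎)
      where
      lemma : ∀ x y → x + y + x ≡ x + (x + y)
      lemma = solve-∀
    s*m≤n : s * m ≤ n
    s*m≤n = ≤-trans (m≤n+m (s * m) m) [1+s]m≤n
    n′≤2m : n ∸ s * m ≤ m + m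
    n′≤2m = m≤n+o⇒m∸n≤o n (s * m) (begin
      n                  ≤⟨ n≤am ⟩
      a * m              ≡⟨ cong (_* m) a≡2+s ⟩
      m + (m + s * m)    ≡⟨ lemma m (s * m) ⟩
      s * m + (m + m)    ∎)
      where
      lemma : ∀ x y → x + (x + y) ≡ y + (x + x)
      lemma = solve-∀
    n′< : n ∸ s * m < suc m * 2 ^ (t + 1)
    n′< = begin-strict
      n ∸ s * m             ≤⟨ n′≤2m ⟩
      m + m                 <⟨ n<1+n _ ⟩
      suc (m + m)           ≤⟨ n≤1+n _ ⟩
      suc (suc (m + m))     ≡⟨ lemma m ⟩
      suc m * 2 ^ 1         ≤⟨ *-monoʳ-≤ (suc m) (^-monoʳ-≤ 2 (m≤n+m 1 t)) ⟩
      suc m * 2 ^ (t + 1)   ∎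
      where
      lemma : ∀ x → suc (suc (x + x)) ≡ suc x * 2
      lemma = solve-∀

open Numerics
open Level using (_⊔_)

-- Auxiliary facts on finite sums, finite sets and lists

sum-single : ∀ {c ℓ} (M : Monoid c ℓ) → let open Monoid M ; open MonoidSum M in
  ∀ {n} (i : Fin n) (f : Fin n → Carrier) → (∀ j → ¬ j ≡ i → f j ≈ ε) → sum f ≈ f i
sum-single M zero f off = trans (∙-congˡ (tailZero (f ∘ suc) λ j → off (suc j) λ ())) (identityʳ (f zero))
  where
  open Monoid M
  open MonoidSum M
  tailZero : ∀ {n} (g : Fin n → Carrier) → (∀ j → g j ≈ ε) → sum g ≈ ε
  tailZero {n} g g≈ε = trans (sum-cong-≋ {x = g} {y = λ _ → ε} g≈ε) (sum-replicate-zero n)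
sum-single M (suc i) f off = trans
  (∙-cong (off zero λ ()) (sum-single M i (f ∘ suc) λ j j≢i → off (suc j) (j≢i ∘ Fin.suc-injective)))
  (identityˡ (f (suc i)))
  where open Monoid M

-- If `y` were missed, `punchOut` at `y` would inject `suc n` elements into `n`.
injective⇒surjective : ∀ {n} (f : Fin n → Fin n) → (∀ i j → f i ≡ f j → i ≡ j) → ∀ y → ∃ λ x → f x ≡ y
injective⇒surjective {suc n} f inj y with any? (λ x → f x Fin.≟ y)
... | yes found = found
... | no none = contradiction
  (Fin.injective⇒≤ {f = λ x → punchOut {i = y} {f x} λ eq → none (x , ≡.sym eq)}
    λ {i} {j} eq → inj i j (punchOut-injective {i = y} _ _ eq))
  ℕ.1+n≰n

length-filter+ : ∀ {a p} {A : Set a} {P : Pred A p} (P? : Decidable₁ P) xs →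
  length xs ≤ length (List.filter P? xs) ℕ.+ length (List.filter (¬? ∘ P?) xs)
length-filter+ P? [] = z≤n
length-filter+ P? (x ∷ xs) with P? x
... | yes _ = s≤s (length-filter+ P? xs)
... | no _  = ℕ.≤-trans (s≤s (length-filter+ P? xs)) (ℕ.≤-reflexive (≡.sym (ℕ.+-suc _ _)))

module RankMetric {c₁ ℓ₁ c₂ ℓ₂ : Level} (K : Field c₁ ℓ₁) (L : Field c₂ ℓ₂)
  (ι : Field.Carrier K → Field.Carrier L) (ι-hom : IsFieldHom K L ι)
  (q m : ℕ) (K-card : HasCard K q) (deg : Ext.Degree K L ι m) where

  open Ext K L ι
  open SemiringSum L.semiring
    using (sum; sum-cong-≋; ∑-distrib-+; ∑-comm; *-distribˡ-sum; *-distribʳ-sum; sum-replicate-zero; sum-init-last)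
  open SemiringExp L.semiring using (_^_; ^-congˡ; ^-homo-*)
  open CommutativeMonoidSum L.*-commutativeMonoid using ()
    renaming (sum to prod; sum-cong-≋ to prod-cong-≋; ∑-distrib-+ to prod-distrib; sum-permute to prod-permute)
  open RingMorphisms.IsRingHomomorphism ι-hom
    using () renaming (⟦⟧-cong to ι-cong; +-homo to ι-+; *-homo to ι-*; 0#-homo to ι-0; 1#-homo to ι-1)
  module Kⁿ = SemiringSum K.semiring
  module L+ = GroupProperties L.+-group
  open import Relation.Binary.Reasoning.Setoid L.setoid
  open import Algebra.Solver.Ring.NaturalCoefficients.Default L.commutativeSemiring
    using (solve; _:=_; _:+_; _:*_; con)

  -- Linear combinations with coefficients in `K`

  infix 7 _·_
  _·_ : ∀ {n} → (Fin n → K.Carrier) → (Fin n → L.Carrier) → L.Carrier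
  a · v = sum (λ i → ι (a i) L.* v i)

  sum-cong : ∀ {n} (f g : Fin n → L.Carrier) → (∀ i → f i L.≈ g i) → sum f L.≈ sum g
  sum-cong f g = sum-cong-≋ {x = f} {y = g}

  sum-zero : ∀ {n} (f : Fin n → L.Carrier) → (∀ i → f i L.≈ L.0#) → sum f L.≈ L.0#
  sum-zero {n} f f≈0 = L.trans (sum-cong f (λ _ → L.0#) f≈0) (sum-replicate-zero n)

  ·-cong : ∀ {n} (a b : Fin n → K.Carrier) v w → (∀ i → a i K.≈ b i) → (∀ i → v i L.≈ w i) → a · v L.≈ b · w
  ·-cong a b v w a≈b v≈w = sum-cong (λ i → ι (a i) L.* v i) (λ i → ι (b i) L.* w i)
    λ i → L.*-cong (ι-cong (a≈b i)) (v≈w i)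

  ·-congˡ : ∀ {n} (a : Fin n → K.Carrier) v w → (∀ i → v i L.≈ w i) → a · v L.≈ a · w
  ·-congˡ a v w = ·-cong a a v w (λ _ → K.refl)

  ·-congʳ : ∀ {n} (a b : Fin n → K.Carrier) v → (∀ i → a i K.≈ b i) → a · v L.≈ b · v
  ·-congʳ a b v a≈b = ·-cong a b v v a≈b (λ _ → L.refl)

  ·-zeroˡ : ∀ {n} (a : Fin n → K.Carrier) v → (∀ i → a i K.≈ K.0#) → a · v L.≈ L.0#
  ·-zeroˡ a v a≈0 = sum-zero (λ i → ι (a i) L.* v i)
    λ i → L.trans (L.*-congʳ (L.trans (ι-cong (a≈0 i)) ι-0)) (L.zeroˡ (v i))

  ·-+ : ∀ {n} (a b : Fin n → K.Carrier) v → (λ i → a i K.+ b i) · v L.≈ a · v L.+ b · v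
  ·-+ a b v = L.trans
    (sum-cong (λ i → ι (a i K.+ b i) L.* v i) (λ i → ι (a i) L.* v i L.+ ι (b i) L.* v i)
      λ i → L.trans (L.*-congʳ (ι-+ (a i) (b i))) (L.distribʳ (v i) (ι (a i)) (ι (b i))))
    (∑-distrib-+ (λ i → ι (a i) L.* v i) (λ i → ι (b i) L.* v i))

  sum-linear : ∀ {n} (f g : Fin n → L.Carrier) c →
               sum (λ i → f i L.+ c L.* g i) L.≈ sum f L.+ c L.* sum g
  sum-linear f g c = begin
    sum (λ i → f i L.+ c L.* g i)      ≈⟨ ∑-distrib-+ f (λ i → c L.* g i) ⟩
    sum f L.+ sum (λ i → c L.* g i)    ≈⟨ L.+-congˡ (*-distribˡ-sum c g) ⟨
    sum f L.+ c L.* sum g              ∎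

  ·-linear : ∀ {n} (a : Fin n → K.Carrier) v c w →
             a · (λ i → v i L.+ c L.* w i) L.≈ a · v L.+ c L.* (a · w)
  ·-linear a v c w = begin
    a · (λ i → v i L.+ c L.* w i)                             ≈⟨ sum-cong _ _ (λ i →
      solve 4 (λ a v c w → a :* (v :+ c :* w) := a :* v :+ c :* (a :* w)) L.refl (ι (a i)) (v i) c (w i)) ⟩
    sum (λ i → ι (a i) L.* v i L.+ c L.* (ι (a i) L.* w i))   ≈⟨ sum-linear (λ i → ι (a i) L.* v i) (λ i → ι (a i) L.* w i) c ⟩
    a · v L.+ c L.* (a · w)                                   ∎

  unit : ∀ {n} → Fin n → Fin n → L.Carrier
  unit zero    zero    = L.1#
  unit zero    (suc j) = L.0#
  unit (suc i) zero    = L.0#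
  unit (suc i) (suc j) = unit i j

  sum-unit : ∀ {n} (i : Fin n) (v : Fin n → L.Carrier) → sum (λ j → unit i j L.* v j) L.≈ v i
  sum-unit zero    v = L.trans (L.+-cong (L.*-identityˡ _) (sum-zero (λ j → L.0# L.* v (suc j)) λ j → L.zeroˡ _)) (L.+-identityʳ _)
  sum-unit (suc i) v = L.trans (L.+-cong (L.zeroˡ _) (sum-unit i (v ∘ suc))) (L.+-identityˡ _)

  unitK : ∀ {n} → Fin n → Fin n → K.Carrier
  unitK zero    zero    = K.1#
  unitK zero    (suc j) = K.0#
  unitK (suc i) zero    = K.0#
  unitK (suc i) (suc j) = unitK i j

  unitK-· : ∀ {n} (i : Fin n) v → unitK i · v L.≈ v i
  unitK-· zero    v = L.trans
    (L.+-cong (L.trans (L.*-congʳ ι-1) (L.*-identityˡ _)) (·-zeroˡ (λ _ → K.0#) (v ∘ suc) λ _ → K.refl)) (L.+-identityʳ _)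
  unitK-· (suc i) v = L.trans
    (L.+-cong (L.trans (L.*-congʳ ι-0) (L.zeroˡ _)) (unitK-· i (v ∘ suc))) (L.+-identityˡ _)

  ι-sum : ∀ {n} (f : Fin n → K.Carrier) → ι (Kⁿ.sum f) L.≈ sum (ι ∘ f)
  ι-sum {zero}  f = ι-0
  ι-sum {suc n} f = L.trans (ι-+ _ _) (L.+-congˡ (ι-sum (f ∘ suc)))

  _⊙_ : ∀ {n r} → (Fin r → K.Carrier) → (Fin r → Fin n → K.Carrier) → Fin n → K.Carrier
  (a ⊙ B) j = Kⁿ.sum (λ i → a i K.* B i j)

  ·-assoc : ∀ {n r} (a : Fin r → K.Carrier) (B : Fin r → Fin n → K.Carrier) v →
            a · (λ i → B i · v) L.≈ (a ⊙ B) · v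
  ·-assoc {n} {r} a B v = begin
    sum (λ i → ι (a i) L.* sum (λ j → ι (B i j) L.* v j))     ≈⟨ sum-cong _ (λ i → sum (λ j → t i j)) (λ i →
                                                                  *-distribˡ-sum (ι (a i)) (λ j → ι (B i j) L.* v j)) ⟩
    sum (λ i → sum (λ j → t i j))                             ≈⟨ ∑-comm t ⟩
    sum (λ j → sum (λ i → t i j))                             ≈⟨ sum-cong _ _ factor ⟩
    sum (λ j → ι (Kⁿ.sum (λ i → a i K.* B i j)) L.* v j)      ∎
    where
    t : Fin r → Fin n → L.Carrier
    t i j = ι (a i) L.* (ι (B i j) L.* v j)
    factor : ∀ j → sum (λ i → t i j) L.≈ ι (Kⁿ.sum (λ i → a i K.* B i j)) L.* v j
    factor j = begin
      sum (λ i → t i j)                                 ≈⟨ sum-cong _ (λ i → ι (a i K.* B i j) L.* v j) (λ i →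
        L.trans (L.sym (L.*-assoc _ _ _)) (L.*-congʳ (L.sym (ι-* (a i) (B i j))))) ⟩
      sum (λ i → ι (a i K.* B i j) L.* v j)             ≈⟨ *-distribʳ-sum (v j) (λ i → ι (a i K.* B i j)) ⟨
      sum (λ i → ι (a i K.* B i j)) L.* v j             ≈⟨ L.*-congʳ (ι-sum (λ i → a i K.* B i j)) ⟨
      ι (Kⁿ.sum (λ i → a i K.* B i j)) L.* v j          ∎

  indep⇒injective : ∀ {k r} {u : Fin r → Vec k} → KIndep u → ∀ a b → kComb a u ≋ kComb b u → ∀ i → a i K.≈ b i
  indep⇒injective {u = u} indep a b eq i =
    K.trans (K.sym (diff+b i)) (K.trans (K.+-congʳ (indep diff diff·u≈0 i)) (K.+-identityˡ _))
    where
    diff : Fin _ → K.Carrier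
    diff i = a i K.- b i
    diff+b : ∀ i → diff i K.+ b i K.≈ a i
    diff+b i = K.trans (K.+-assoc _ _ _) (K.trans (K.+-congˡ (K.-‿inverseˡ (b i))) (K.+-identityʳ _))
    diff·u≈0 : kComb diff u ≋ zeroV
    diff·u≈0 j = L+.∙-cancelʳ (kComb b u j) _ _ (begin
      kComb diff u j L.+ kComb b u j           ≈⟨ ·-+ diff b (λ i → u i j) ⟨
      (λ i → diff i K.+ b i) · (λ i → u i j)   ≈⟨ ·-congʳ (λ i → diff i K.+ b i) a (λ i → u i j) diff+b ⟩
      kComb a u j                              ≈⟨ eq j ⟩
      kComb b u j                              ≈⟨ L.+-identityˡ _ ⟨
      L.0# L.+ kComb b u j                     ∎)

  -- Decidability and counting from the finiteness of `K`

  _≟K_ : Decidable K._≈_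
  _≟K_ = proj₁ K-card

  elemK : Fin q → K.Carrier
  elemK = proj₁ (proj₂ K-card)

  elemK-injective : ∀ i j → elemK i K.≈ elemK j → i ≡ j
  elemK-injective = proj₁ (proj₂ (proj₂ K-card))

  indexK : K.Carrier → Fin q
  indexK x = proj₁ (proj₂ (proj₂ (proj₂ K-card)) x)

  elemK-indexK : ∀ x → elemK (indexK x) K.≈ x
  elemK-indexK x = proj₂ (proj₂ (proj₂ (proj₂ K-card)) x)

  basis : Fin m → L.Carrier
  basis = proj₁ deg

  coords : L.Carrier → Fin m → K.Carrier
  coords x = proj₁ (proj₂ (proj₂ deg) x)

  coords-· : ∀ x → coords x · basis L.≈ x
  coords-· x = proj₂ (proj₂ (proj₂ deg) x)

  basis-indep : ∀ a → a · basis L.≈ L.0# → ∀ i → a i K.≈ K.0#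
  basis-indep a eq = proj₁ (proj₂ deg) a (λ _ → eq)

  -- Reduced to the coordinates over `K`, where equality is decidable.
  ≈0? : ∀ x → Dec (x L.≈ L.0#)
  ≈0? x with Fin.all? (λ i → coords x i ≟K K.0#)
  ... | yes all = yes (L.trans (L.sym (coords-· x)) (·-zeroˡ (coords x) basis all))
  ... | no ¬all = no λ x≈0 → ¬all (basis-indep _ (L.trans (coords-· x) x≈0))

  _≟L_ : Decidable L._≈_
  x ≟L y = map′ (L+.x∙y⁻¹≈ε⇒x≈y x y) L+.x≈y⇒x∙y⁻¹≈ε (≈0? (x L.- y))

  1<q : 1 < q
  1<q = ℕ.≰⇒> λ q≤1 → K.1≉0 (K.trans (K.sym (elemK-indexK K.1#)) (K.trans
    (K.reflexive (≡.cong elemK (toℕ-injective (≡.trans (toℕ≡0 q≤1 (indexK K.1#)) (≡.sym (toℕ≡0 q≤1 (indexK K.0#)))))))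
    (elemK-indexK K.0#)))
    where
    toℕ≡0 : q ≤ 1 → (i : Fin q) → toℕ i ≡ 0
    toℕ≡0 q≤1 i = ℕ.n<1⇒n≡0 (ℕ.<-≤-trans (toℕ<n i) q≤1)

  vecK : ∀ r → Fin (q ℕ.^ r) → Fin r → K.Carrier
  vecK r i = elemK ∘ finToFun i

  funToFin-cong : ∀ {r s} (f g : Fin r → Fin s) → (∀ i → f i ≡ g i) → funToFin f ≡ funToFin g
  funToFin-cong {zero}  f g eq = ≡.refl
  funToFin-cong {suc r} f g eq =
    ≡.cong₂ combine (eq zero) (funToFin-cong (f ∘ suc) (g ∘ suc) (eq ∘ suc))

  vecK-injective : ∀ r i j → (∀ l → vecK r i l K.≈ vecK r j l) → i ≡ j
  vecK-injective r i j eq = ≡.trans (≡.sym (Fin.funToFin-finToFin {r} i))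
    (≡.trans (funToFin-cong _ _ λ l → elemK-injective _ _ (eq l)) (Fin.funToFin-finToFin {r} j))

  indexVecK : ∀ r → (Fin r → K.Carrier) → Fin (q ℕ.^ r)
  indexVecK r a = funToFin (indexK ∘ a)

  vecK-index : ∀ r a l → vecK r (indexVecK r a) l K.≈ a l
  vecK-index r a l = K.trans (K.reflexive (≡.cong elemK (Fin.finToFun-funToFin (indexK ∘ a) l))) (elemK-indexK (a l))

  -- By counting: q ^ r ≤ q ^ s.
  injective⇒dim≤ : ∀ {r s} (f : (Fin r → K.Carrier) → (Fin s → K.Carrier)) →
    (∀ a b → (∀ i → f a i K.≈ f b i) → ∀ i → a i K.≈ b i) → r ≤ s
  injective⇒dim≤ {r} {s} f inj = ℕ.≮⇒≥ λ s<r → ℕ.<⇒≱ (ℕ.^-monoʳ-< q 1<q s<r)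
    (Fin.injective⇒≤ {f = indexVecK s ∘ f ∘ vecK r} λ {i} {j} eq → vecK-injective r i j
      (inj _ _ λ l → K.trans (K.sym (vecK-index s _ l))
        (K.trans (K.reflexive (≡.cong (λ z → vecK s z l) eq)) (vecK-index s _ l))))

  -- The upper bound

  -- If `B` expresses `u` through `v`, independence of `u` makes `a ↦ ψ (a ⊙ B)` injective.
  -- Dimensions are compared by counting, so `ψ` may be any map.
  dim≤ : ∀ {k w n s} {u : Fin w → Vec k} {v : Fin n → Vec k} → KIndep u → (∀ i → InKSpan v (u i)) →
    (ψ : (Fin n → K.Carrier) → Fin s → K.Carrier) →
    (∀ b b′ → (∀ i → ψ b i K.≈ ψ b′ i) → kComb b v ≋ kComb b′ v) → w ≤ s
  dim≤ {u = u} {v} indep u∈v ψ determines = injective⇒dim≤ (λ a → ψ (a ⊙ B)) λ a a′ eq →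
    indep⇒injective {u = u} indep a a′ λ l →
      L.trans (L.sym (change a l)) (L.trans (determines (a ⊙ B) (a′ ⊙ B) eq l) (change a′ l))
    where
    B = λ i → proj₁ (u∈v i)
    change : ∀ a → kComb (a ⊙ B) v ≋ kComb a u
    change a l = L.trans (L.sym (·-assoc a B (λ j → v j l)))
      (·-congˡ a (λ i → B i · (λ j → v j l)) (λ i → u i l) λ i → proj₂ (u∈v i) l)

  Linear : ∀ {k} → (Vec k → L.Carrier) → Set (c₂ ⊔ ℓ₂)
  Linear f = ∀ x c y → f (λ l → x l L.+ c L.* y l) L.≈ f x L.+ c L.* f y

  module _ {n k} (G : Matrix k n) where

    -- The functional `x` applied to the combination of the columns of `G` with coefficients `b`.
    value : Vec k → (Fin n → K.Carrier) → L.Carrier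
    value x b = b · codeword G x

    value-linear : ∀ b → Linear (λ x → value x b)
    value-linear b x c y = L.trans
      (·-congˡ b (codeword G (λ l → x l L.+ c L.* y l)) (λ j → codeword G x j L.+ c L.* codeword G y j) λ j →
        L.trans (sum-cong (λ i → (x i L.+ c L.* y i) L.* G i j) (λ i → x i L.* G i j L.+ c L.* (y i L.* G i j)) λ i →
            solve 4 (λ x c y g → (x :+ c :* y) :* g := x :* g :+ c :* (y :* g)) L.refl (x i) c (y i) (G i j))
          (sum-linear (λ i → x i L.* G i j) (λ i → y i L.* G i j) c))
      (·-linear b (codeword G x) c (codeword G y))

    value-zero : ∀ x b → (∀ l → x l L.≈ L.0#) → value x b L.≈ L.0#
    value-zero x b x≈0 = sum-zero (λ j → ι (b j) L.* codeword G x j) λ j → L.trans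
      (L.*-congˡ (sum-zero (λ i → x i L.* G i j) λ i → L.trans (L.*-congʳ (x≈0 i)) (L.zeroˡ _))) (L.zeroʳ _)

    value-unit : ∀ l b → value (unit l) b L.≈ kComb b (column G) l
    value-unit l b = ·-congˡ b (codeword G (unit l)) (G l) λ j → sum-unit l (λ i → G i j)

    -- Some s coordinates of b ∈ Kⁿ determine the value of the codeword of y at b, i.e. the weight is at most s.
    Determined : Vec k → ℕ → Set (c₁ ⊔ ℓ₁ ⊔ ℓ₂)
    Determined y s = Σ ((Fin n → K.Carrier) → Fin s → K.Carrier) λ ψ →
      ∀ b b′ → (∀ i → ψ b i K.≈ ψ b′ i) → value y b L.≈ value y b′

    weight⇒determined : ∀ {y w} → RankWeight (codeword G y) w → Determined y w
    weight⇒determined {y} {w} (u , _ , _ , spans) = (λ b → proj₁ (coefs b)) , λ b b′ eq → begin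
      value y b                                    ≈⟨ proj₂ (coefs b) zero ⟨
      proj₁ (coefs b) · (λ i → u i zero)           ≈⟨ ·-congʳ (proj₁ (coefs b)) (proj₁ (coefs b′)) (λ i → u i zero) eq ⟩
      proj₁ (coefs b′) · (λ i → u i zero)          ≈⟨ proj₂ (coefs b′) zero ⟩
      value y b′                                   ∎
      where
      coefs : ∀ b → InKSpan u (λ _ → value y b)
      coefs b = spans (λ _ → value y b) (b , λ _ → L.refl)

    weight≤ : ∀ {y w s} → RankWeight (codeword G y) w → Determined y s → w ≤ s
    weight≤ (u , indep , u∈v , _) (ψ , determines) = dim≤ {u = u} indep u∈v ψ λ b b′ eq _ → determines b b′ eq

    determined-length : ∀ y → Determined y n
    determined-length y = id , λ b b′ eq → ·-congʳ b b′ (codeword G y) eq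

    determined-degree : ∀ y → Determined y m
    determined-degree y = (λ b → coords (value y b)) , λ b b′ eq → begin
      value y b                     ≈⟨ coords-· _ ⟨
      coords (value y b) · basis    ≈⟨ ·-congʳ (coords (value y b)) (coords (value y b′)) basis eq ⟩
      coords (value y b′) · basis   ≈⟨ coords-· _ ⟩
      value y b′                    ∎

    -- With no coordinate to record, every value equals the value at `b = 0`; at unit vectors the
    -- values are the entries of the codeword.
    0<weight : ∀ {w} → InWS G w → 0 < w
    0<weight {suc w} _ = s≤s z≤n
    0<weight {zero} (x , nonzero , rw) with weight⇒determined {x} rw
    ... | ψ , determines = contradiction (λ j → L.trans (L.sym (unitK-· j (codeword G x)))
      (L.trans (determines (unitK j) (λ _ → K.0#) λ ()) (·-zeroˡ (λ _ → K.0#) (codeword G x) λ _ → K.refl))) nonzero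

    module _ (M : ℕ) (M-determines : ∀ y → Determined y M) where

      -- j codewords have been chosen; the kernel of the d functionals Q is their L-span, and S
      -- coordinates determine all codewords in it.  c distinct weights, all at most E, have been met,
      -- and g of the numbers 1, …, E are no weights.
      record Chain (d E c : ℕ) : Set (c₁ ⊔ ℓ₁ ⊔ c₂ ⊔ ℓ₂) where
        field
          j S g      : ℕ
          Q          : Fin d → Vec k → L.Carrier
          Q-linear   : ∀ i → Linear (Q i)
          j+d≡k      : j ℕ.+ d ≡ k
          g+c≡E      : g ℕ.+ c ≡ E
          E≤S        : E ≤ S
          bound      : ChainBound M j S g
          ψ          : (Fin n → K.Carrier) → Fin S → K.Carrier
          determines : ∀ b b′ → (∀ i → ψ b i K.≈ ψ b′ i) → ∀ x → (∀ i → Q i x L.≈ L.0#) → value x b L.≈ value x b′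

      emptyChain : Chain k 0 0
      emptyChain = record
        { j = 0 ; S = 0 ; g = 0
        -- The coordinate functionals have zero kernel, the span of no words.
        ; Q = λ l x → x l ; Q-linear = λ _ _ _ _ → L.refl
        ; j+d≡k = ≡.refl ; g+c≡E = ≡.refl ; E≤S = z≤n ; bound = bound-start {M}
        ; ψ = λ _ () ; determines = λ b b′ _ x x≈0 → L.trans (value-zero x b x≈0) (L.sym (value-zero x b′ x≈0))
        }

      -- Gaussian elimination with pivot `Q p y`: `Q p` is dropped, and a multiple of it is
      -- subtracted from the other functionals to make them vanish at `y`. Subtracting a multiple of
      -- `y` moves a vector of the new kernel into the old one, so `ψ` and the coordinates for `y`
      -- together determine its values.
      addWord : ∀ {d E c} (ch : Chain (suc d) E c) → let open Chain ch in
        ∀ y p → ¬ Q p y L.≈ L.0# → ∀ {e} → Determined y e → e ≤ M →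
        ∀ δ {E′ c′} → g ℕ.+ δ ℕ.+ c′ ≡ E′ → E′ ≤ S ℕ.+ e → e ≤ δ ℕ.+ suc S → Chain d E′ c′
      addWord ch y p Qpy≉0 {e} (ψy , determines-y) e≤M δ {E′} {c′} eq E′≤ e≤ = record
        { j = suc j ; S = S ℕ.+ e ; g = g ℕ.+ δ
        ; Q = Q′ ; Q-linear = Q′-linear
        ; j+d≡k = ≡.trans (≡.sym (ℕ.+-suc j _)) j+d≡k ; g+c≡E = eq ; E≤S = E′≤
        ; bound = bound-step {M} {j} {S} {g} e δ e≤M e≤ bound
        ; ψ = λ b → [ ψ b , ψy b ]′ ∘ splitAt S
        ; determines = determines′
        }
        where
        open Chain ch
        v = L.- proj₁ (L.inverse (Q p y) Qpy≉0)
        1+Qpy*v≈0 : L.1# L.+ Q p y L.* v L.≈ L.0#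
        1+Qpy*v≈0 = begin
          L.1# L.+ Q p y L.* v                                            ≈⟨ L.+-cong (L.sym (proj₂ (L.inverse (Q p y) Qpy≉0))) L.refl ⟩
          Q p y L.* proj₁ (L.inverse (Q p y) Qpy≉0) L.+ Q p y L.* v       ≈⟨ L.distribˡ (Q p y) _ v ⟨
          Q p y L.* (proj₁ (L.inverse (Q p y) Qpy≉0) L.+ v)               ≈⟨ L.*-congˡ (L.-‿inverseʳ _) ⟩
          Q p y L.* L.0#                                                  ≈⟨ L.zeroʳ _ ⟩
          L.0#                                                            ∎
        Q′ : Fin _ → Vec k → L.Carrier
        Q′ i x = Q (punchIn p i) x L.+ Q (punchIn p i) y L.* v L.* Q p x
        Q′-linear : ∀ i → Linear (Q′ i)
        Q′-linear i x c z = L.trans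
          (L.+-cong (Q-linear (punchIn p i) x c z) (L.*-congˡ (Q-linear p x c z)))
          (solve 6 (λ a c b t a′ b′ → (a :+ c :* b) :+ t :* (a′ :+ c :* b′) := (a :+ t :* a′) :+ c :* (b :+ t :* b′))
            L.refl (Q (punchIn p i) x) c (Q (punchIn p i) z) (Q (punchIn p i) y L.* v) (Q p x) (Q p z))
        determines′ : ∀ b b′ → (∀ i → [ ψ b , ψy b ]′ (splitAt S i) K.≈ [ ψ b′ , ψy b′ ]′ (splitAt S i)) →
          ∀ x → (∀ i → Q′ i x L.≈ L.0#) → value x b L.≈ value x b′
        determines′ b b′ eqs x Q′x≈0 = L+.∙-cancelʳ (t L.* value y b) (value x b) (value x b′) (begin
          value x b L.+ t L.* value y b     ≈⟨ value-linear b x t y ⟨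
          value x₀ b                        ≈⟨ determines b b′ eqψ x₀ Qx₀≈0 ⟩
          value x₀ b′                       ≈⟨ value-linear b′ x t y ⟩
          value x b′ L.+ t L.* value y b′   ≈⟨ L.+-congˡ (L.*-congˡ (determines-y b b′ eqψy)) ⟨
          value x b′ L.+ t L.* value y b    ∎)
          where
          t = Q p x L.* v
          x₀ : Vec k
          x₀ l = x l L.+ t L.* y l
          eqψ : ∀ i → ψ b i K.≈ ψ b′ i
          eqψ i = ≡.subst (λ s → [ ψ b , ψy b ]′ s K.≈ [ ψ b′ , ψy b′ ]′ s) (splitAt-↑ˡ S i e) (eqs (i ↑ˡ e))
          eqψy : ∀ i → ψy b i K.≈ ψy b′ i
          eqψy i = ≡.subst (λ s → [ ψ b , ψy b ]′ s K.≈ [ ψ b′ , ψy b′ ]′ s) (splitAt-↑ʳ S e i) (eqs (S ↑ʳ i))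
          Qx₀≈0 : ∀ i → Q i x₀ L.≈ L.0#
          Qx₀≈0 i with p Fin.≟ i
          ... | yes ≡.refl = begin
            Q p x₀                                 ≈⟨ Q-linear p x t y ⟩
            Q p x L.+ t L.* Q p y                  ≈⟨ solve 3 (λ a v b → a :+ (a :* v) :* b := a :* (con 1 :+ b :* v)) L.refl (Q p x) v (Q p y) ⟩
            Q p x L.* (L.1# L.+ Q p y L.* v)       ≈⟨ L.*-congˡ 1+Qpy*v≈0 ⟩
            Q p x L.* L.0#                         ≈⟨ L.zeroʳ _ ⟩
            L.0#                                   ∎
          ... | no p≢i = ≡.subst (λ i → Q i x₀ L.≈ L.0#) (punchIn-punchOut p≢i) (begin
            Q i′ x₀                                ≈⟨ Q-linear i′ x t y ⟩
            Q i′ x L.+ t L.* Q i′ y                ≈⟨ solve 4 (λ a b v c → a :+ (b :* v) :* c := a :+ (c :* v) :* b) L.refl (Q i′ x) (Q p x) v (Q i′ y) ⟩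
            Q′ (punchOut p≢i) x                    ≈⟨ Q′x≈0 (punchOut p≢i) ⟩
            L.0#                                   ∎)
            where i′ = punchIn p (punchOut p≢i)

      countGap : ∀ g δ c → g ℕ.+ δ ℕ.+ suc c ≡ δ ℕ.+ suc (g ℕ.+ c)
      countGap = solve-∀

      -- If every `Q i` vanishes at `y`, then `e ≤ S` and only the skipped values are recorded.
      -- Otherwise `y` is chosen, and `E ≤ S` gives `e ≤ δ + suc S`.
      addWeight : ∀ {d E c e} → Chain d E c → E < e → InWS G e → ∃ λ d′ → Chain d′ e (suc c)
      addWeight {d} {E} {c} {e} ch E<e (y , _ , rw) = add d ch
        where
        -- Counts the numbers strictly between `E` and `e`.
        δ = e ℕ.∸ suc E
        δ+1+E≡e : δ ℕ.+ suc E ≡ e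
        δ+1+E≡e = ℕ.m∸n+n≡m E<e
        gap : ∀ g → g ℕ.+ c ≡ E → g ℕ.+ δ ℕ.+ suc c ≡ e
        gap g g+c≡E = ≡.trans (countGap g δ c) (≡.trans (≡.cong (λ z → δ ℕ.+ suc z) g+c≡E) δ+1+E≡e)
        add : ∀ d → Chain d E c → ∃ λ d′ → Chain d′ e (suc c)
        add d ch with any? (λ i → ¬? (≈0? (Chain.Q ch i y)))
        add d ch | no none = d , record
          { j = j ; S = S ; g = g ℕ.+ δ ; Q = Q ; Q-linear = Q-linear ; j+d≡k = j+d≡k
          ; g+c≡E = gap g g+c≡E
          ; E≤S = weight≤ {y} rw (ψ , λ b b′ eq → determines b b′ eq y λ i →
                    decidable-stable (≈0? (Q i y)) λ Qiy≉0 → none (i , Qiy≉0))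
          ; bound = bound-mono {M} {j} {S} (ℕ.m≤m+n g δ) bound
          ; ψ = ψ ; determines = determines }
          where open Chain ch
        add (suc d) ch | yes (p , Qpy≉0) = d ,
          addWord ch y p Qpy≉0 (weight⇒determined {y} rw) (weight≤ {y} rw (M-determines y)) δ
            (gap g g+c≡E) (ℕ.m≤n+m e S)
            (ℕ.≤-trans (ℕ.≤-reflexive (≡.sym δ+1+E≡e)) (ℕ.+-monoʳ-≤ δ (s≤s E≤S)))
          where open Chain ch

      -- The words chosen for the weights met need not generate the code. Unit vectors are added,
      -- with `M` as weight bound, until the remaining functionals vanish on all of them.
      saturate : ∀ d {E c} → E ≤ M → Chain d E c →
        ∃₂ λ d′ E′ → E′ ≤ M × Σ (Chain d′ E′ c) λ ch → ∀ i l → Chain.Q ch i (unit l) L.≈ L.0#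
      saturate zero E≤M ch = zero , _ , E≤M , ch , λ ()
      saturate (suc d) {E} {c} E≤M ch with any? (λ i → any? (λ l → ¬? (≈0? (Chain.Q ch i (unit l)))))
      ... | no none = suc d , E , E≤M , ch , λ i l → decidable-stable (≈0? _) λ ≉0 → none (i , l , ≉0)
      ... | yes (p , l , ≉0) = saturate d ℕ.≤-refl (addWord ch (unit l) p ≉0 (M-determines (unit l)) ℕ.≤-refl
              -- The first addition counts all numbers from `suc E` to `M` as skipped and raises `E`
              -- to `M`; later ones skip nothing.
              (M ℕ.∸ E)
              (≡.trans (≡.trans (swapLast g (M ℕ.∸ E) c) (≡.cong (M ℕ.∸ E ℕ.+_) g+c≡E)) (ℕ.m∸n+n≡m E≤M))
              (ℕ.m≤n+m M S)
              (ℕ.≤-trans (ℕ.≤-reflexive (≡.sym (ℕ.m∸n+n≡m E≤M))) (ℕ.+-monoʳ-≤ (M ℕ.∸ E) (ℕ.m≤n⇒m≤1+n E≤S))))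
        where
        open Chain ch
        swapLast : ∀ g δ c → g ℕ.+ δ ℕ.+ c ≡ δ ℕ.+ (g ℕ.+ c)
        swapLast = solve-∀

      module _ {N} (e : Fin N → ℕ) (e-injective : ∀ i j → e i ≡ e j → i ≡ j) (e∈WS : ∀ i → InWS G (e i)) where

        -- Visiting the values `r` in increasing order ensures the hypothesis `E < e` of
        -- `addWeight`.
        scan : ∀ r → r ≤ M → ∃₂ λ d E → ∃ λ xs → E ≤ r × Chain d E (length xs) × (∀ i → e i ≤ r → e i ∈ xs)
        scan zero    _ = k , 0 , [] , z≤n , emptyChain , λ i ei≤0 → contradiction (0<weight (e∈WS i)) (ℕ.≤⇒≯ ei≤0)
        scan (suc r) 1+r≤M with scan r (ℕ.<⇒≤ 1+r≤M) | any? (λ i → e i ℕ.≟ suc r)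
        ... | d , E , xs , E≤r , ch , met | no none = d , E , xs , ℕ.m≤n⇒m≤1+n E≤r , ch , λ i ei≤ →
          met i (ℕ.m<1+n⇒m≤n (ℕ.≤∧≢⇒< ei≤ λ eq → none (i , eq)))
        ... | d , E , xs , E≤r , ch , met | yes (i₀ , eq₀) with addWeight ch (s≤s E≤r) (≡.subst (InWS G) eq₀ (e∈WS i₀))
        ...   | d′ , ch′ = d′ , suc r , suc r ∷ xs , ℕ.≤-refl , ch′ , met′
          where
          met′ : ∀ i → e i ≤ suc r → e i ∈ suc r ∷ xs
          met′ i ei≤ with e i ℕ.≟ suc r
          ... | yes eq = here eq
          ... | no neq = there (met i (ℕ.m<1+n⇒m≤n (ℕ.≤∧≢⇒< ei≤ neq)))

        -- After saturation, `S` coordinates determine every combination of the columns, so the `n`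
        -- independent vectors supplied by nondegeneracy force `n ≤ S`.
        spectrumBound : Nondegenerate G → ∃₂ λ j d → ∃₂ λ S g →
          j ℕ.+ d ≡ k × ChainBound M j S g × n ≤ S × g ℕ.+ N ≤ M
        spectrumBound (u , indep , u∈v , _) with scan M ℕ.≤-refl
        ... | d , E , xs , E≤M , ch , met with saturate d E≤M ch
        ...   | d′ , E′ , E′≤M , ch′ , killed = j , d′ , S , g , j+d≡k , bound ,
          dim≤ {u = u} indep u∈v ψ (λ b b′ eq l → L.trans (L.sym (value-unit l b))
            (L.trans (determines b b′ eq (unit l) (λ i → killed i l)) (value-unit l b′))) ,
          ℕ.≤-trans (ℕ.≤-trans (ℕ.+-monoʳ-≤ g N≤c) (ℕ.≤-reflexive g+c≡E)) E′≤M
          where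
          open Chain ch′
          e∈xs : ∀ i → e i ∈ xs
          e∈xs i = met i (weight≤ {proj₁ (e∈WS i)} (proj₂ (proj₂ (e∈WS i))) (M-determines _))
          N≤c : N ≤ length xs
          N≤c = Fin.injective⇒≤ {f = λ i → index (e∈xs i)} λ {i} {j} eq → e-injective i j
            (≡.trans (lookup-index (e∈xs i)) (≡.trans (≡.cong (List.lookup xs) eq) (≡.sym (lookup-index (e∈xs j)))))

  -- Existence of a primitive element

  *-cancelˡ-≈ : ∀ x {y z} → ¬ x L.≈ L.0# → x L.* y L.≈ x L.* z → y L.≈ z
  *-cancelˡ-≈ x {y} {z} x≉0 eq = begin
    y                   ≈⟨ undo y ⟨
    v L.* (x L.* y)     ≈⟨ L.*-congˡ eq ⟩
    v L.* (x L.* z)     ≈⟨ undo z ⟩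
    z                   ∎
    where
    v = proj₁ (L.inverse x x≉0)
    undo : ∀ y → v L.* (x L.* y) L.≈ y
    undo y = L.trans (solve 3 (λ v x y → v :* (x :* y) := (x :* v) :* y) L.refl v x y)
      (L.trans (L.*-congʳ (proj₂ (L.inverse x x≉0))) (L.*-identityˡ y))

  *-≉0 : ∀ {x y} → ¬ x L.≈ L.0# → ¬ y L.≈ L.0# → ¬ x L.* y L.≈ L.0#
  *-≉0 {x} x≉0 y≉0 eq = y≉0 (*-cancelˡ-≈ x x≉0 (L.trans eq (L.sym (L.zeroʳ x))))

  -- Monic polynomials: horner (c₀ ∷ … ∷ c_{d-1} ∷ []) x = c₀ + … + c_{d-1} x^{d-1} + x^d.
  horner : ∀ {d} → Vec.Vec L.Carrier d → L.Carrier → L.Carrier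
  horner []       x = L.1#
  horner (c ∷ cs) x = c L.+ x L.* horner cs x

  quotient : ∀ {d} → L.Carrier → Vec.Vec L.Carrier (suc d) → Vec.Vec L.Carrier d
  quotient a (c ∷ [])      = []
  quotient a (c ∷ c′ ∷ cs) = horner (c′ ∷ cs) a ∷ quotient a (c′ ∷ cs)

  -- p(y) = (y − a) quotient(y) + p(a), with the negative term moved to the left.
  horner-quotient : ∀ {d} a (cs : Vec.Vec L.Carrier (suc d)) y →
    horner cs y L.+ a L.* horner (quotient a cs) y L.≈ y L.* horner (quotient a cs) y L.+ horner cs a
  horner-quotient a (c ∷ [])      y =
    solve 4 (λ c y a o → (c :+ y :* o) :+ a :* o := y :* o :+ (c :+ a :* o)) L.refl c y a L.1#
  horner-quotient a (c ∷ c′ ∷ cs) y = begin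
    (c L.+ y L.* Py) L.+ a L.* (Pa L.+ y L.* R)  ≈⟨ solve 6 (λ c y Py a Pa R →
      (c :+ y :* Py) :+ a :* (Pa :+ y :* R) := (c :+ y :* (Py :+ a :* R)) :+ a :* Pa) L.refl c y Py a Pa R ⟩
    (c L.+ y L.* (Py L.+ a L.* R)) L.+ a L.* Pa  ≈⟨ L.+-congʳ (L.+-congˡ (L.*-congˡ (horner-quotient a (c′ ∷ cs) y))) ⟩
    (c L.+ y L.* (y L.* R L.+ Pa)) L.+ a L.* Pa  ≈⟨ solve 5 (λ c y a Pa R →
      (c :+ y :* (y :* R :+ Pa)) :+ a :* Pa := y :* (Pa :+ y :* R) :+ (c :+ a :* Pa)) L.refl c y a Pa R ⟩
    y L.* (Pa L.+ y L.* R) L.+ (c L.+ a L.* Pa)  ∎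
    where
    Py = horner (c′ ∷ cs) y
    Pa = horner (c′ ∷ cs) a
    R  = horner (quotient a (c′ ∷ cs)) y

  Distinct : List L.Carrier → Set (c₂ ⊔ ℓ₂)
  Distinct = AllPairs (λ x y → ¬ x L.≈ y)

  -- The quotient by a root vanishes at every other root, and a monic polynomial of degree 0 is the
  -- constant 1.
  roots≤degree : ∀ {d} (cs : Vec.Vec L.Carrier d) {xs} → Distinct xs →
    All (λ x → horner cs x L.≈ L.0#) xs → length xs ≤ d
  roots≤degree cs [] [] = z≤n
  roots≤degree [] (_ ∷ _) (1≈0 ∷ _) = contradiction 1≈0 L.1≉0
  roots≤degree cs@(_ ∷ _) {x ∷ xs} (x≉xs ∷ distinct) (px≈0 ∷ pxs≈0) =
    s≤s (roots≤degree (quotient x cs) distinct (All.zipWith root (x≉xs , pxs≈0)))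
    where
    root : ∀ {y} → (¬ x L.≈ y) × horner cs y L.≈ L.0# → horner (quotient x cs) y L.≈ L.0#
    root {y} (x≉y , py≈0) = decidable-stable (≈0? R) λ R≉0 → x≉y (*-cancelˡ-≈ R R≉0 (begin
      R L.* x                     ≈⟨ L.*-comm R x ⟩
      x L.* R                     ≈⟨ L.+-identityˡ _ ⟨
      L.0# L.+ x L.* R            ≈⟨ L.+-congʳ py≈0 ⟨
      horner cs y L.+ x L.* R     ≈⟨ horner-quotient x cs y ⟩
      y L.* R L.+ horner cs x     ≈⟨ L.+-congˡ px≈0 ⟩
      y L.* R L.+ L.0#            ≈⟨ L.+-identityʳ _ ⟩
      y L.* R                     ≈⟨ L.*-comm y R ⟩
      R L.* y                     ∎))
      where R = horner (quotient x cs) y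

  fixed≤ : ∀ Q → 2 ≤ Q → ∀ {xs} → Distinct xs → All (λ x → x ^ Q L.≈ x) xs → length xs ≤ Q
  fixed≤ (suc (suc Q)) (s≤s (s≤s _)) distinct fixed =
    -- Since the degree is at least two, the term `-X` lies strictly below the leading one.
    roots≤degree (L.0# ∷ L.- L.1# ∷ replicate Q L.0#) distinct (All.map (λ {x} → root x) fixed)
    where
    horner-zeros : ∀ n x → horner (replicate n L.0#) x L.≈ x ^ n
    horner-zeros zero    x = L.refl
    horner-zeros (suc n) x = L.trans (L.+-identityˡ _) (L.*-congˡ (horner-zeros n x))
    root : ∀ x → x ^ suc (suc Q) L.≈ x → horner (L.0# ∷ L.- L.1# ∷ replicate Q L.0#) x L.≈ L.0#
    root x eq = begin
      L.0# L.+ x L.* (L.- L.1# L.+ x L.* horner (replicate Q L.0#) x)   ≈⟨ L.+-identityˡ _ ⟩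
      x L.* (L.- L.1# L.+ x L.* horner (replicate Q L.0#) x)            ≈⟨ L.*-congˡ (L.+-congˡ (L.*-congˡ (horner-zeros Q x))) ⟩
      x L.* (L.- L.1# L.+ x L.* x ^ Q)                                  ≈⟨ L.distribˡ x _ _ ⟩
      x L.* (L.- L.1#) L.+ x ^ suc (suc Q)                              ≈⟨ L.+-congˡ (L.trans eq (L.sym (L.*-identityʳ x))) ⟩
      x L.* (L.- L.1#) L.+ x L.* L.1#                                   ≈⟨ L.distribˡ x _ _ ⟨
      x L.* (L.- L.1# L.+ L.1#)                                         ≈⟨ L.*-congˡ (L.-‿inverseˡ L.1#) ⟩
      x L.* L.0#                                                        ≈⟨ L.zeroʳ x ⟩
      L.0#                                                              ∎

  -- Bounds the number of elements fixed by `x ↦ x ^ (q ^ r)` for some `r` from 1 to `s`.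
  powersBelow : ℕ → ℕ
  powersBelow zero    = 0
  powersBelow (suc s) = powersBelow s ℕ.+ q ℕ.^ suc s

  powersBelow< : ∀ s → powersBelow s < q ℕ.^ suc s
  powersBelow< zero    = ℕ.≤-trans (ℕ.<⇒≤ 1<q) (ℕ.≤-reflexive (≡.sym (ℕ.*-identityʳ q)))
  powersBelow< (suc s) = ℕ.<-≤-trans (ℕ.+-monoˡ-< (q ℕ.^ suc s) (powersBelow< s))
    (ℕ.≤-trans (ℕ.≤-reflexive (≡.cong (q ℕ.^ suc s ℕ.+_) (≡.sym (ℕ.+-identityʳ _)))) (ℕ.*-monoˡ-≤ (q ℕ.^ suc s) 1<q))

  -- At most `q ^ suc s` elements are discarded for the largest exponent, which leaves more than
  -- `powersBelow s` for the smaller ones.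
  avoidFixed : ∀ s {xs} → Distinct xs → powersBelow s < length xs →
    ∃ λ x → x ∈ xs × (∀ r → 1 ≤ r → r ≤ s → ¬ x ^ (q ℕ.^ r) L.≈ x)
  avoidFixed zero {x ∷ _} _ _ = x , here ≡.refl , λ { (suc r) _ () }
  avoidFixed (suc s) {xs} distinct long = extend (avoidFixed s (AllPairs.filter⁺ (¬? ∘ fixed?) distinct)
      (ℕ.+-cancelʳ-< Q (powersBelow s) _ (ℕ.<-≤-trans long few)))
    where
    Q : ℕ
    Q = q ℕ.^ suc s
    fixed? : Decidable₁ (λ x → x ^ Q L.≈ x)
    fixed? x = (x ^ Q) ≟L x
    2≤Q : 2 ≤ Q
    2≤Q = ℕ.≤-trans 1<q (ℕ.≤-trans (ℕ.≤-reflexive (≡.sym (ℕ.*-identityʳ q)))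
      (ℕ.^-monoʳ-≤ q {{ℕ.>-nonZero (ℕ.<⇒≤ 1<q)}} (s≤s (z≤n {s}))))
    few : length xs ≤ length (List.filter (¬? ∘ fixed?) xs) ℕ.+ Q
    few = ℕ.≤-trans (length-filter+ fixed? xs) (ℕ.≤-trans
      (ℕ.+-monoˡ-≤ _ (fixed≤ Q 2≤Q (AllPairs.filter⁺ fixed? distinct) (all-filter fixed? xs)))
      (ℕ.≤-reflexive (ℕ.+-comm Q _)))
    extend : (∃ λ x → x ∈ List.filter (¬? ∘ fixed?) xs × (∀ r → 1 ≤ r → r ≤ s → ¬ x ^ (q ℕ.^ r) L.≈ x)) →
             ∃ λ x → x ∈ xs × (∀ r → 1 ≤ r → r ≤ suc s → ¬ x ^ (q ℕ.^ r) L.≈ x)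
    extend (x , x∈ , notFixed) with ∈-filter⁻ (¬? ∘ fixed?) {xs = xs} x∈
    ... | x∈xs , ¬fixed = x , x∈xs , below
      where
      below : ∀ r → 1 ≤ r → r ≤ suc s → ¬ x ^ (q ℕ.^ r) L.≈ x
      below r 1≤r r≤ with ℕ.m≤n⇒m<n∨m≡n r≤
      ... | inj₁ (s≤s r≤s) = notFixed r 1≤r r≤s
      ... | inj₂ ≡.refl    = ¬fixed

  -- Linear dependence among the powers of an element

  powers : L.Carrier → ∀ r → Fin r → L.Carrier
  powers x r i = x ^ toℕ i

  PowersIndep : L.Carrier → ℕ → Set (c₁ ⊔ ℓ₁ ⊔ ℓ₂)
  PowersIndep x r = ∀ a → a · powers x r L.≈ L.0# → ∀ i → a i K.≈ K.0#

  ·-scale : ∀ {r} c (a : Fin r → K.Carrier) v → (λ i → c K.* a i) · v L.≈ ι c L.* (a · v)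
  ·-scale c a v = L.trans
    (sum-cong (λ i → ι (c K.* a i) L.* v i) (λ i → ι c L.* (ι (a i) L.* v i))
      λ i → L.trans (L.*-congʳ (ι-* c (a i))) (L.*-assoc _ _ _))
    (L.sym (*-distribˡ-sum (ι c) (λ i → ι (a i) L.* v i)))

  prod-cong : ∀ {n} (f g : Fin n → L.Carrier) → (∀ i → f i L.≈ g i) → prod f L.≈ prod g
  prod-cong f g = prod-cong-≋ {x = f} {y = g}

  prod-≉0 : ∀ {n} (f : Fin n → L.Carrier) → (∀ i → ¬ f i L.≈ L.0#) → ¬ prod f L.≈ L.0#
  prod-≉0 {zero}  f f≉0 = L.1≉0
  prod-≉0 {suc n} f f≉0 = *-≉0 (f≉0 zero) (prod-≉0 (f ∘ suc) (f≉0 ∘ suc))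

  module _ (x : L.Carrier) where

    InPowers : ℕ → L.Carrier → Set (c₁ ⊔ ℓ₂)
    InPowers r y = ∃ λ (a : Fin r → K.Carrier) → a · powers x r L.≈ y

    inPowers? : ∀ r y → Dec (InPowers r y)
    inPowers? r y with any? (λ i → (vecK r i · powers x r) ≟L y)
    ... | yes (i , eq) = yes (vecK r i , eq)
    ... | no none      = no λ (a , eq) → none (indexVecK r a ,
            L.trans (·-congʳ (vecK r (indexVecK r a)) a (powers x r) (vecK-index r a)) eq)

    ·-powers-suc : ∀ {r} (a : Fin (suc r) → K.Carrier) →
      a · powers x (suc r) L.≈ (a ∘ inject₁) · powers x r L.+ ι (a (fromℕ r)) L.* x ^ r
    ·-powers-suc {r} a = L.trans (sum-init-last (λ i → ι (a i) L.* powers x (suc r) i)) (L.+-cong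
      (·-congˡ (a ∘ inject₁) (powers x (suc r) ∘ inject₁) (powers x r) λ i → L.reflexive (≡.cong (x ^_) (toℕ-inject₁ i)))
      (L.*-congˡ (L.reflexive (≡.cong (x ^_) (toℕ-fromℕ r)))))

    -- A relation with nonzero top coefficient can be solved for `x ^ r`; with top coefficient zero
    -- it is a relation among lower powers.
    indep-suc : ∀ {r} → PowersIndep x r → ¬ InPowers r (x ^ r) → PowersIndep x (suc r)
    indep-suc {r} indep ∉ a eq with a (fromℕ r) ≟K K.0#
    ... | yes aᵣ≈0 = λ i → allZero i
      where
      init≈0 : ∀ i → a (inject₁ i) K.≈ K.0#
      init≈0 = indep (a ∘ inject₁) (begin
        (a ∘ inject₁) · powers x r                                      ≈⟨ L.+-identityʳ _ ⟨
        (a ∘ inject₁) · powers x r L.+ L.0#                             ≈⟨ L.+-congˡ (L.zeroˡ _) ⟨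
        (a ∘ inject₁) · powers x r L.+ L.0# L.* x ^ r                   ≈⟨ L.+-congˡ (L.*-congʳ (L.trans (ι-cong aᵣ≈0) ι-0)) ⟨
        (a ∘ inject₁) · powers x r L.+ ι (a (fromℕ r)) L.* x ^ r        ≈⟨ ·-powers-suc a ⟨
        a · powers x (suc r)                                            ≈⟨ eq ⟩
        L.0#                                                            ∎)
      allZero : ∀ i → a i K.≈ K.0#
      allZero i with toℕ i ℕ.<? r
      ... | yes i<r = ≡.subst (λ i → a i K.≈ K.0#)
              (Fin.toℕ-injective (≡.trans (toℕ-inject₁ (fromℕ< i<r)) (toℕ-fromℕ< i<r))) (init≈0 (fromℕ< i<r))
      ... | no i≮r = ≡.subst (λ i → a i K.≈ K.0#)
              (Fin.toℕ-injective (≡.trans (toℕ-fromℕ r) (ℕ.≤-antisym (ℕ.≮⇒≥ i≮r) (ℕ.m<1+n⇒m≤n (toℕ<n i))))) aᵣ≈0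
    ... | no aᵣ≉0 = contradiction ((λ i → c K.* a (inject₁ i)) , c·≈) ∉
      where
      c′ = proj₁ (K.inverse (a (fromℕ r)) aᵣ≉0)
      c = K.- c′
      1+c*aᵣ≈0 : K.1# K.+ c K.* a (fromℕ r) K.≈ K.0#
      1+c*aᵣ≈0 = K.trans (K.+-congʳ (K.trans (K.sym (proj₂ (K.inverse (a (fromℕ r)) aᵣ≉0))) (K.*-comm _ c′)))
        (K.trans (K.sym (K.distribʳ (a (fromℕ r)) c′ c)) (K.trans (K.*-congʳ (K.-‿inverseʳ c′)) (K.zeroˡ _)))
      s = (a ∘ inject₁) · powers x r
      t = ι (c K.* a (fromℕ r)) L.* x ^ r
      c·≈ : (λ i → c K.* a (inject₁ i)) · powers x r L.≈ x ^ r
      c·≈ = L.trans (·-scale c (a ∘ inject₁) (powers x r)) (L+.∙-cancelʳ t (ι c L.* s) (x ^ r) (begin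
        ι c L.* s L.+ ι (c K.* a (fromℕ r)) L.* x ^ r         ≈⟨ L.+-congˡ (L.trans (L.*-congʳ (ι-* c _)) (L.*-assoc _ _ _)) ⟩
        ι c L.* s L.+ ι c L.* (ι (a (fromℕ r)) L.* x ^ r)     ≈⟨ L.distribˡ (ι c) _ _ ⟨
        ι c L.* (s L.+ ι (a (fromℕ r)) L.* x ^ r)             ≈⟨ L.*-congˡ (L.trans (L.sym (·-powers-suc a)) eq) ⟩
        ι c L.* L.0#                                          ≈⟨ L.zeroʳ _ ⟩
        L.0#                                                  ≈⟨ L.zeroˡ _ ⟨
        L.0# L.* x ^ r                                        ≈⟨ L.*-congʳ (L.trans (ι-cong 1+c*aᵣ≈0) ι-0) ⟨
        ι (K.1# K.+ c K.* a (fromℕ r)) L.* x ^ r              ≈⟨ L.*-congʳ (L.trans (ι-+ _ _) (L.+-congʳ ι-1)) ⟩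
        (L.1# L.+ ι (c K.* a (fromℕ r))) L.* x ^ r            ≈⟨ L.distribʳ (x ^ r) _ _ ⟩
        L.1# L.* x ^ r L.+ t                                  ≈⟨ L.+-congʳ (L.*-identityˡ _) ⟩
        x ^ r L.+ t                                           ∎))

    indepOrDependent : ∀ r → PowersIndep x r ⊎ ∃ λ s → s < r × PowersIndep x s × InPowers s (x ^ s)
    indepOrDependent zero = inj₁ λ _ _ ()
    indepOrDependent (suc r) with indepOrDependent r
    ... | inj₂ (s , s<r , rest) = inj₂ (s , ℕ.m≤n⇒m≤1+n s<r , rest)
    ... | inj₁ indep with inPowers? r (x ^ r)
    ...   | yes ∈ᵣ = inj₂ (r , ℕ.≤-refl , indep , ∈ᵣ)
    ...   | no ∉ᵣ  = inj₁ (indep-suc indep ∉ᵣ)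

    prod-const : ∀ {n} (f : Fin n → L.Carrier) → (∀ i → f i L.≈ x) → prod f L.≈ x ^ n
    prod-const {zero}  f f≈x = L.refl
    prod-const {suc n} f f≈x = L.*-cong (f≈x zero) (prod-const (f ∘ suc) (f≈x ∘ suc))

    -- The extra `x` replaces the factor lost at `i₀`, which avoids the exponent `n ∸ 1`.
    prod-almostConst : ∀ {n} (i₀ : Fin n) (f : Fin n → L.Carrier) → f i₀ L.≈ L.1# →
      (∀ i → ¬ i ≡ i₀ → f i L.≈ x) → x L.* prod f L.≈ x ^ n
    prod-almostConst zero     f f₀≈1 f≈x = L.*-congˡ (L.trans (L.*-congʳ f₀≈1)
      (L.trans (L.*-identityˡ _) (prod-const (f ∘ suc) λ i → f≈x (suc i) λ ())))
    prod-almostConst (suc i₀) f f₀≈1 f≈x = L.*-congˡ (L.trans (L.*-congʳ (f≈x zero λ ()))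
      (prod-almostConst i₀ (f ∘ suc) f₀≈1 λ i i≢ → f≈x (suc i) (i≢ ∘ Fin.suc-injective)))

    -- Multiplication by x permutes the span of 1, …, x^{s-1}; compare the products of its nonzero elements.
    dependent⇒fixed : ∀ {s} → PowersIndep x s → InPowers s (x ^ s) → x ^ (q ℕ.^ s) L.≈ x
    dependent⇒fixed {s} indep (top , top·≈) with ≈0? x
    ... | yes x≈0 = L.trans (^-congˡ N x≈0) (L.trans (zeroPower N (ℕ.m^n>0 q {{ℕ.>-nonZero (ℕ.<⇒≤ 1<q)}} s)) (L.sym x≈0))
      where
      N = q ℕ.^ s
      zeroPower : ∀ N → 0 < N → L.0# ^ N L.≈ L.0#
      zeroPower (suc N) _ = L.zeroˡ _
    ... | no x≉0 = begin
      x ^ N               ≈⟨ prod-almostConst i₀ scale scale₀ scaleᵢ ⟨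
      x L.* prod scale    ≈⟨ L.*-congˡ prodScale≈1 ⟩
      x L.* L.1#          ≈⟨ L.*-identityʳ x ⟩
      x                   ∎
      where
      N = q ℕ.^ s
      el : Fin N → L.Carrier
      el i = vecK s i · powers x s
      el-injective : ∀ i j → el i L.≈ el j → i ≡ j
      el-injective i j eq = vecK-injective s i j
        (indep⇒injective {k = 1} {u = λ i _ → powers x s i} (λ a eq → indep a (eq zero)) (vecK s i) (vecK s j) λ _ → eq)
      -- Multiplication by `x` sends each power to the next one; the last becomes `x ^ s`, which
      -- `top` expands.
      shiftRow : ∀ i → InPowers s (x ^ suc (toℕ i))
      shiftRow i with suc (toℕ i) ℕ.<? s
      ... | yes 1+i<s = unitK (fromℕ< 1+i<s) ,
              L.trans (unitK-· (fromℕ< 1+i<s) (powers x s)) (L.reflexive (≡.cong (x ^_) (toℕ-fromℕ< 1+i<s)))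
      ... | no 1+i≮s = top , L.trans top·≈ (L.reflexive (≡.cong (x ^_) (ℕ.≤-antisym (ℕ.≮⇒≥ 1+i≮s) (toℕ<n i))))
      B : Fin s → Fin s → K.Carrier
      B i = proj₁ (shiftRow i)
      σ : Fin N → Fin N
      σ i = indexVecK s (vecK s i ⊙ B)
      el-σ : ∀ i → el (σ i) L.≈ x L.* el i
      el-σ i = begin
        el (σ i)                                           ≈⟨ ·-congʳ (vecK s (σ i)) (vecK s i ⊙ B) (powers x s) (vecK-index s (vecK s i ⊙ B)) ⟩
        (vecK s i ⊙ B) · powers x s                        ≈⟨ ·-assoc (vecK s i) B (powers x s) ⟨
        vecK s i · (λ l → B l · powers x s)                ≈⟨ sum-cong _ (λ l → x L.* (ι (vecK s i l) L.* x ^ toℕ l)) (λ l →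
          L.trans (L.*-congˡ (proj₂ (shiftRow l)))
            (solve 3 (λ a x y → a :* (x :* y) := x :* (a :* y)) L.refl (ι (vecK s i l)) x (x ^ toℕ l))) ⟩
        sum (λ l → x L.* (ι (vecK s i l) L.* x ^ toℕ l))   ≈⟨ *-distribˡ-sum x (λ l → ι (vecK s i l) L.* x ^ toℕ l) ⟨
        x L.* el i                                         ∎
      σ-injective : ∀ i j → σ i ≡ σ j → i ≡ j
      σ-injective i j eq = el-injective i j (*-cancelˡ-≈ x x≉0 (L.trans (L.sym (el-σ i))
        (L.trans (L.reflexive (≡.cong el eq)) (el-σ j))))
      σ⁻¹ : ∀ j → ∃ λ i → σ i ≡ j
      σ⁻¹ = injective⇒surjective σ σ-injective
      π : Permutation N N
      π = permutation σ (proj₁ ∘ σ⁻¹) (λ j → proj₂ (σ⁻¹ j)) (λ i → σ-injective _ _ (proj₂ (σ⁻¹ (σ i))))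
      -- Zero is replaced by one so that the product may run over the whole span; `scale` is one at
      -- the zero element to match.
      nonzero : L.Carrier → L.Carrier
      nonzero y with ≈0? y
      ... | yes _ = L.1#
      ... | no _  = y
      nonzero-≉0 : ∀ y → ¬ nonzero y L.≈ L.0#
      nonzero-≉0 y with ≈0? y
      ... | yes _  = L.1≉0
      ... | no y≉0 = y≉0
      scale : Fin N → L.Carrier
      scale i with ≈0? (el i)
      ... | yes _ = L.1#
      ... | no _  = x
      i₀ : Fin N
      i₀ = indexVecK s (λ _ → K.0#)
      el-i₀ : el i₀ L.≈ L.0#
      el-i₀ = ·-zeroˡ (vecK s i₀) (powers x s) (vecK-index s (λ _ → K.0#))
      scale₀ : scale i₀ L.≈ L.1#
      scale₀ with ≈0? (el i₀)
      ... | yes _  = L.refl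
      ... | no ≉0  = contradiction el-i₀ ≉0
      scaleᵢ : ∀ i → ¬ i ≡ i₀ → scale i L.≈ x
      scaleᵢ i i≢i₀ with ≈0? (el i)
      ... | yes ≈0 = contradiction (el-injective i i₀ (L.trans ≈0 (L.sym el-i₀))) i≢i₀
      ... | no _   = L.refl
      nonzero-σ : ∀ i → nonzero (el (σ i)) L.≈ scale i L.* nonzero (el i)
      nonzero-σ i with ≈0? (el (σ i)) | ≈0? (el i)
      ... | yes _     | yes _     = L.sym (L.*-identityʳ L.1#)
      ... | yes σ≈0   | no i≉0    = contradiction (L.trans (L.sym (el-σ i)) σ≈0) (*-≉0 x≉0 i≉0)
      ... | no σ≉0    | yes i≈0   = contradiction (L.trans (el-σ i) (L.trans (L.*-congˡ i≈0) (L.zeroʳ x))) σ≉0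
      ... | no _      | no _      = el-σ i
      prodScale≈1 : prod scale L.≈ L.1#
      prodScale≈1 = *-cancelˡ-≈ P (prod-≉0 (nonzero ∘ el) (nonzero-≉0 ∘ el)) (begin
        P L.* prod scale                            ≈⟨ L.*-comm P _ ⟩
        prod scale L.* P                            ≈⟨ prod-distrib scale (nonzero ∘ el) ⟨
        prod (λ i → scale i L.* nonzero (el i))     ≈⟨ prod-cong (nonzero ∘ el ∘ σ) (λ i → scale i L.* nonzero (el i)) nonzero-σ ⟨
        prod (nonzero ∘ el ∘ σ)                     ≈⟨ prod-permute (nonzero ∘ el) π ⟨
        P                                           ≈⟨ L.*-identityʳ P ⟨
        P L.* L.1#                                  ∎)
        where P = prod (nonzero ∘ el)

  -- The `q ^ m` elements of `L` outnumber those fixed by a `q ^ r`-th power with `1 ≤ r < m`. For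
  -- an element that none of them fixes, `dependent⇒fixed` excludes a dependence.
  primitiveElement : 1 ≤ m → ∃ λ β → PowersIndep β m
  primitiveElement 1≤m with avoidFixed (ℕ.pred m) {List.tabulate element} distinct enough
    where
    element : Fin (q ℕ.^ m) → L.Carrier
    element i = vecK m i · basis
    distinct : Distinct (List.tabulate element)
    distinct = AllPairs.tabulate⁺ λ {i} {j} i≢j eq → i≢j (vecK-injective m i j
      (indep⇒injective {k = 1} {u = λ i _ → basis i} (proj₁ (proj₂ deg)) (vecK m i) (vecK m j) λ _ → eq))
    enough : powersBelow (ℕ.pred m) < length (List.tabulate element)
    enough = ℕ.<-≤-trans (powersBelow< (ℕ.pred m)) (ℕ.≤-reflexive (≡.trans
      (≡.cong (q ℕ.^_) (ℕ.suc-pred m {{ℕ.>-nonZero 1≤m}})) (≡.sym (length-tabulate element))))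
  ... | β , _ , notFixed with indepOrDependent β m
  ...   | inj₁ indep = β , indep
  ...   | inj₂ (zero , _ , _ , (_ , 0≈1)) = contradiction (L.sym 0≈1) L.1≉0
  ...   | inj₂ (suc s , s<m , indep , ∈ₛ) = contradiction (dependent⇒fixed β indep ∈ₛ)
            (notFixed (suc s) (s≤s z≤n) (ℕ.pred-mono-≤ s<m))

  -- Codes attaining the bound

  unitK-diagonal : ∀ {n} (i : Fin n) → unitK i i ≡ K.1#
  unitK-diagonal zero    = ≡.refl
  unitK-diagonal (suc i) = unitK-diagonal i

  unitK-off : ∀ {n} (i j : Fin n) → ¬ i ≡ j → unitK i j ≡ K.0#
  unitK-off zero    zero    i≢j = contradiction ≡.refl i≢j
  unitK-off zero    (suc j) i≢j = ≡.refl
  unitK-off (suc i) zero    i≢j = ≡.refl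
  unitK-off (suc i) (suc j) i≢j = unitK-off i j (i≢j ∘ ≡.cong suc)

  -- `nothing` marks a zero entry, so a map into `Maybe (Fin r)` describes a family drawn from `v`
  -- with zeros and repetitions.
  at : ∀ {r} → (Fin r → L.Carrier) → Maybe (Fin r) → L.Carrier
  at v (just t) = v t
  at v nothing  = L.0#

  rowAt : ∀ {r} → Maybe (Fin r) → Fin r → K.Carrier
  rowAt (just t) = unitK t
  rowAt nothing  = λ _ → K.0#

  rowAt-· : ∀ {r} (v : Fin r → L.Carrier) t → rowAt t · v L.≈ at v t
  rowAt-· v (just t) = unitK-· t v
  rowAt-· v nothing  = ·-zeroˡ (λ _ → K.0#) v λ _ → K.refl

  reindex : ∀ {r s} (v : Fin r → L.Carrier) (w : Fin s → L.Carrier) (τ : Fin s → Maybe (Fin r)) →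
    (∀ j → w j L.≈ at v (τ j)) → ∀ a → a · w L.≈ (a ⊙ (rowAt ∘ τ)) · v
  reindex v w τ w≈ a = L.trans
    (·-congˡ a w (λ j → rowAt (τ j) · v) λ j → L.trans (w≈ j) (L.sym (rowAt-· v (τ j))))
    (·-assoc a (rowAt ∘ τ) v)

  -- Rewritten in terms of `v`, the combination has coefficient `a j` at `t`, because no other index
  -- is sent to `t`.
  reindex-indep : ∀ {r s} (v : Fin r → L.Carrier) (w : Fin s → L.Carrier) (τ : Fin s → Maybe (Fin r)) →
    (∀ a → a · v L.≈ L.0# → ∀ i → a i K.≈ K.0#) → (∀ j → w j L.≈ at v (τ j)) →
    (∀ i j t → τ i ≡ just t → τ j ≡ just t → i ≡ j) →
    ∀ a → a · w L.≈ L.0# → ∀ j t → τ j ≡ just t → a j K.≈ K.0#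
  reindex-indep {r} {s} v w τ indep w≈ τ-injective a a·w≈0 j t τj≡t = K.trans (K.sym collapse)
    (indep (a ⊙ (rowAt ∘ τ)) (L.trans (L.sym (reindex v w τ w≈ a)) a·w≈0) t)
    where
    offRow : ∀ i τi → τ i ≡ τi → ¬ i ≡ j → rowAt τi t K.≈ K.0#
    offRow i nothing   _  _   = K.refl
    offRow i (just t′) eq i≢j = K.reflexive (unitK-off t′ t λ t′≡t →
      i≢j (τ-injective i j t (≡.trans eq (≡.cong just t′≡t)) τj≡t))
    collapse : (a ⊙ (rowAt ∘ τ)) t K.≈ a j
    collapse = K.trans (sum-single K.+-monoid j (λ i → a i K.* rowAt (τ i) t) λ i i≢j →
        K.trans (K.*-congˡ (offRow i (τ i) ≡.refl i≢j)) (K.zeroʳ (a i)))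
      (K.trans (K.*-congˡ (K.reflexive (≡.trans (≡.cong (λ z → rowAt z t) τj≡t) (unitK-diagonal t)))) (K.*-identityʳ (a j)))

  module LayoutCode {D n k} (ℓ : Layout m D k n) (β : L.Carrier) (β-indep : PowersIndep β m) where
    open Layout ℓ

    β^≉0 : ∀ {p} → p < m → ¬ β ^ p L.≈ L.0#
    β^≉0 {p} p<m β^p≈0 = K.1≉0 (K.trans (K.reflexive (≡.sym (unitK-diagonal (fromℕ< p<m))))
      (β-indep (unitK (fromℕ< p<m)) (L.trans (unitK-· (fromℕ< p<m) (powers β m))
        (L.trans (L.reflexive (≡.cong (β ^_) (toℕ-fromℕ< p<m))) β^p≈0)) (fromℕ< p<m)))

    entry : Fin k → Fin n → Maybe (Fin m)
    entry i j with block j Fin.≟ i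
    ... | yes _ = just (fromℕ< (exponent<m j))
    ... | no _  = nothing

    entry-just : ∀ i j t → entry i j ≡ just t → block j ≡ i × exponent j ≡ toℕ t
    entry-just i j t eq with block j Fin.≟ i
    entry-just i j t ≡.refl | yes b≡i = b≡i , ≡.sym (toℕ-fromℕ< (exponent<m j))

    entry-block : ∀ j → entry (block j) j ≡ just (fromℕ< (exponent<m j))
    entry-block j with block j Fin.≟ block j
    ... | yes _ = ≡.refl
    ... | no ≢  = contradiction ≡.refl ≢

    entry-off : ∀ i j → ¬ i ≡ block j → entry i j ≡ nothing
    entry-off i j i≢ with block j Fin.≟ i
    ... | yes ≡b = contradiction (≡.sym ≡b) i≢
    ... | no _   = ≡.refl

    G : Matrix k n
    G i j = at (powers β m) (entry i j)

    codeword-G : ∀ x j → codeword G x j L.≈ x (block j) L.* β ^ exponent j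
    codeword-G x j = L.trans
      (sum-single L.+-monoid (block j) (λ i → x i L.* G i j) λ i i≢ →
        L.trans (L.*-congˡ (L.reflexive (≡.cong (at (powers β m)) (entry-off i j i≢)))) (L.zeroʳ (x i)))
      (L.*-congˡ (L.reflexive (≡.trans (≡.cong (at (powers β m)) (entry-block j))
        (≡.cong (β ^_) (toℕ-fromℕ< (exponent<m j))))))

    G-rows : RowsLIndep G
    G-rows x xG≈0 i with surjective i
    ... | j , ≡.refl = decidable-stable (≈0? (x i)) λ xi≉0 →
      *-≉0 xi≉0 (β^≉0 (exponent<m j)) (L.trans (L.sym (codeword-G x j)) (xG≈0 j))

    -- In row `block j` only the columns of that block are nonzero, and they carry distinct powers
    -- of `β`; a relation among the columns, read in this row, forces `a j` to vanish.
    G-nondegenerate : Nondegenerate G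
    G-nondegenerate = column G , indep , (λ j → unitK j , λ l → unitK-· j (G l)) , λ _ → id
      where
      indep : KIndep (column G)
      indep a a·G≈0 j = reindex-indep (powers β m) (G (block j)) (entry (block j)) β-indep (λ _ → L.refl)
        (λ i j′ t eq eq′ → let (bi , ei) = entry-just (block j) i t eq ; (bj , ej) = entry-just (block j) j′ t eq′ in
          injective i j′ (≡.trans bi (≡.sym bj)) (≡.trans ei (≡.sym ej)))
        a (a·G≈0 (block j)) j (fromℕ< (exponent<m j)) (entry-block j)

    -- `onto` puts each of the first `r` powers of `β` among the entries, `below` excludes other
    -- nonzero entries, and `r ≤ m` makes these powers independent.
    G-weight : ∀ r → 1 ≤ r → D ≤ r → r ≤ n → r ≤ m → InWS G r
    G-weight r 1≤r D≤r r≤n r≤m with cover r D≤r r≤n r≤m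
    ... | shift , below , onto = x , nonzero ,
      (λ p _ → powers β r p) , indep , inSpan , spans
      where
      monomial : Maybe ℕ → L.Carrier
      monomial (just e) = β ^ e
      monomial nothing  = L.0#
      x : Vec k
      x = monomial ∘ shift
      value-at : ∀ j e → shift (block j) ≡ just e → codeword G x j L.≈ β ^ (e ℕ.+ exponent j)
      value-at j e eq = L.trans (codeword-G x j)
        (L.trans (L.*-congʳ (L.reflexive (≡.cong monomial eq))) (L.sym (^-homo-* β e (exponent j))))
      nonzero : ¬ codeword G x ≋ zeroV
      nonzero xG≈0 with onto 0 1≤r
      ... | j , e , eq , e+≡0 = L.1≉0 (L.trans (L.sym (L.trans (value-at j e eq)
              (L.reflexive (≡.cong (β ^_) e+≡0)))) (xG≈0 j))
      indep : KIndep {1} (λ p _ → powers β r p)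
      indep a a·≈0 p = reindex-indep (powers β m) (powers β r) (λ p → just (inject≤ p r≤m)) β-indep
        (λ p → L.reflexive (≡.cong (β ^_) (≡.sym (toℕ-inject≤ p r≤m))))
        (λ i j t eq eq′ → inject≤-injective r≤m r≤m i j (just-injective (≡.trans eq (≡.sym eq′))))
        a (a·≈0 zero) p (inject≤ p r≤m) ≡.refl
      inSpan : ∀ p → InKSpan (λ j (_ : Fin 1) → codeword G x j) (λ _ → powers β r p)
      inSpan p with onto (toℕ p) (toℕ<n p)
      ... | j , e , eq , e+≡p = unitK j , λ _ → L.trans (unitK-· j (codeword G x))
              (L.trans (value-at j e eq) (L.reflexive (≡.cong (β ^_) e+≡p)))
      position : ∀ j → ∃ λ t → codeword G x j L.≈ at (powers β r) t
      position j with shift (block j) in eq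
      ... | just e  = just (fromℕ< (below j e eq)) ,
              L.trans (value-at j e eq) (L.reflexive (≡.cong (β ^_) (≡.sym (toℕ-fromℕ< (below j e eq)))))
      ... | nothing = nothing , L.trans (codeword-G x j)
              (L.trans (L.*-congʳ (L.reflexive (≡.cong monomial eq))) (L.zeroˡ _))
      spans : ∀ y → InKSpan (λ j (_ : Fin 1) → codeword G x j) y → InKSpan (λ p _ → powers β r p) y
      spans y (b , b·≈y) = b ⊙ (rowAt ∘ proj₁ ∘ position) , λ l → L.trans
        (L.sym (reindex (powers β r) (codeword G x) (proj₁ ∘ position) (proj₂ ∘ position) b)) (b·≈y l)

  -- The two bounds combined

  module _ {n k} (P : Parameters m n k) where
    open Parameters P

    determined-M : ∀ (G : Matrix k n) y → Determined G y M
    determined-M G y with M≡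
    ... | inj₁ ≡.refl = determined-length G y
    ... | inj₂ ≡.refl = determined-degree G y

    spectrum≤ : ∀ {G : Matrix k n} → Nondegenerate G → ∀ {N} (e : Fin N → ℕ) → (∀ i j → e i ≡ e j → i ≡ j) →
      (∀ i → InWS G (e i)) → N ≤ M ℕ.∸ D ℕ.+ 1
    spectrum≤ {G} nondeg e e-injective e∈WS
      with spectrumBound G M (determined-M G) e e-injective e∈WS nondeg
    ... | j , d , S , g , j+d≡k , bound , n≤S , g+N≤M = count≤ {j} {d} {S} {g} j+d≡k bound n≤S g+N≤M

    isLrk : 1 ≤ m → k ≤ n → IsLrk n k (M ℕ.∸ D ℕ.+ 1)
    isLrk 1≤m k≤n = (G , G-rows , G-nondegenerate , e , e-injective , e∈WS , complete) ,
      λ N (_ , _ , nondeg , f , f-injective , f∈WS , _) → spectrum≤ nondeg f f-injective f∈WS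
      where
      β = primitiveElement 1≤m
      ℓ : Layout m D k n
      ℓ = ≡.subst (λ k → Layout m D k n) (≡.sym k≡)
        (layout 1≤m 1≤D (ℕ.≤-trans D≤M M≤m) (i ℕ.+ s) n (D+i+s≤n 1≤m k≤n) n≤reach)
      open LayoutCode ℓ (proj₁ β) (proj₂ β)
      V = M ℕ.∸ D ℕ.+ 1
      e : Fin V → ℕ
      -- The `+ 1` in `V` makes these values run from `D` to `M` inclusive.
      e j = D ℕ.+ toℕ j
      e-injective : ∀ i j → e i ≡ e j → i ≡ j
      e-injective i j eq = toℕ-injective (ℕ.+-cancelˡ-≡ D _ _ eq)
      e≤M : ∀ j → e j ≤ M
      e≤M j = ℕ.≤-trans (ℕ.+-monoʳ-≤ D (ℕ.m<1+n⇒m≤n (≡.subst (toℕ j <_) (ℕ.+-comm (M ℕ.∸ D) 1) (toℕ<n j))))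
        (ℕ.≤-reflexive (ℕ.m+[n∸m]≡n D≤M))
      e∈WS : ∀ j → InWS G (e j)
      e∈WS j = G-weight (e j) (ℕ.≤-trans 1≤D (ℕ.m≤m+n D (toℕ j))) (ℕ.m≤m+n D (toℕ j))
        (ℕ.≤-trans (e≤M j) M≤n) (ℕ.≤-trans (e≤M j) M≤m)
      -- A further weight would contradict the upper bound.
      complete : ∀ r → InWS G r → ∃ λ j → e j ≡ r
      complete r r∈WS with any? (λ j → e j ℕ.≟ r)
      ... | yes found = found
      ... | no none   = contradiction (spectrum≤ G-nondegenerate e⁺ e⁺-injective e⁺∈WS) ℕ.1+n≰n
        where
        e⁺ : Fin (suc V) → ℕ
        e⁺ zero    = r
        e⁺ (suc j) = e j
        e⁺-injective : ∀ i j → e⁺ i ≡ e⁺ j → i ≡ j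
        e⁺-injective zero    zero    _  = ≡.refl
        e⁺-injective zero    (suc j) eq = contradiction (j , ≡.sym eq) none
        e⁺-injective (suc i) zero    eq = contradiction (i , eq) none
        e⁺-injective (suc i) (suc j) eq = ≡.cong suc (e-injective i j eq)
        e⁺∈WS : ∀ j → InWS G (e⁺ j)
        e⁺∈WS zero    = r∈WS
        e⁺∈WS (suc j) = e∈WS j

mainTheorem1 : ∀ {c₁ ℓ₁ c₂ ℓ₂ : Level}
    (K : Field c₁ ℓ₁) (L : Field c₂ ℓ₂) (ι : Field.Carrier K → Field.Carrier L)
    (q m n k : ℕ) →
    IsFieldHom K L ι →
    IsPrimePower q → HasCard K q → Ext.Degree K L ι m →
    1 ≤ m → 1 ≤ n → 1 ≤ k → k ≤ n → n ≤ k * m →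
    (n ≤ m → Ext.IsLrk K L ι n k (formulaSmall n k)) ×
    (m < n → Ext.IsLrk K L ι n k (formulaLarge n m k))
-- With `m` and `k` in successor form, the parameter records unfold and `M ∸ D + 1` computes to the
-- two formulas.
mainTheorem1 K L ι q m@(suc _) n k@(suc _) ι-hom _ K-card deg 1≤m 1≤n 1≤k k≤n n≤km =
  (λ n≤m → isLrk (parametersSmall 1≤n 1≤k n≤m) 1≤m k≤n) ,
  (λ m<n → isLrk (parametersLarge 1≤m m<n n≤km) 1≤m k≤n)
  where open RankMetric K L ι ι-hom q m K-card deg
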